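{- Let $k\geq 5$, $t\geq 1$ and $\beta\ge0$ be integers with $\gamma=1+\beta\leq k-2$, and let $n$ be sufficiently large (depending on $k,t,\gamma$). Let $\mathcal{F}\subseteq\binom{[n]}{k}$ be a $(1,t)$-union intersecting family with $\ell(\mathcal{F})\geq\gamma$. Then $$|\mathcal{F}|\leq\binom{n-1}{k-1}-\binom{n-k}{k-1}+\binom{n-k-\gamma}{k-\gamma-1}+\gamma t.$$ Equality holds if and only if $\mathcal{F}$ is isomorphic to a family $\mathcal{J}^{1,t}_{\gamma}$ (as defined in the context).
   Context: $\binom{[n]}{k}$ is the family of $k$-subsets of $[n]$. A family is intersecting if any two members meet. $\mathcal{F}$ is $(1,t)$-union intersecting if for any pairwise distinct $A_1,\ldots,A_{t+1}\in\mathcal{F}$, $A_1\cap(\bigcup_{i=2}^{t+1}A_i)\neq\varnothing$. $\ell(\mathcal{F})$ is the minimum number of members of $\mathcal{F}$ whose removal leaves an intersecting family. Two families are isomorphic if some permutation of $[n]$ maps one onto the other. Construction $\mathcal{J}^{1,t}_i$ ($1\le i\le k-1$): take an $(i+1)$-set $J=\{1,x_1,\ldots,x_i\}\subseteq[n]$, a $(k-1)$-set $E\subseteq[n]\setminus J$, and let $A_j=E\cup\{x_j\}$ for $j\le i$. Let $\mathcal{S}_1(A_1,\ldots,A_i:1)=\{A\in\binom{[n]}{k}:1\in A,\ A\cap A_j\ne\varnothing\text{ for all }j\le i\}$. For each $j\le i$, let $\mathcal{B}_j$ be a family of $t-1$ distinct $k$-sets $B$ with $B\cap E=\varnothing$ and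 $J\setminus B=\{x_j\}$. Then $\mathcal{J}^{1,t}_i=\mathcal{S}_1(A_1,\ldots,A_i:1)\cup\{A_1,\ldots,A_i\}\cup\mathcal{B}_1\cup\cdots\cup\mathcal{B}_i$. -}

module Defs where

open import Data.Nat using (ℕ; suc; _+_; _*_; _∸_; _≤_)
open import Data.Nat.Combinatorics using (_C_)
open import Data.Fin using (Fin)
open import Data.Fin.Subset using (Subset; _∈_; _∉_; _∩_; _∪_; ⋃; ⁅_⁆; ∣_∣; Nonempty; Empty)
open import Data.Fin.Permutation using (Permutation′; _⟨$⟩ˡ_)
open import Data.Vec using (tabulate; lookup)
open import Data.List using (List; _∷_; length)
open import Data.List.Relation.Unary.All using (All)
open import Data.List.Relation.Unary.Unique.Propositional using (Unique)
open import Data.List.Membership.Propositional using () renaming (_∈_ to _∈ᴸ_)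
open import Data.Product using (Σ; ∃; _×_)
open import Data.Sum using (_⊎_)
open import Relation.Binary.PropositionalEquality using (_≡_; _≢_)
open import Relation.Nullary using (¬_)

KFamily : (n k : ℕ) → List (Subset n) → Set
KFamily n k F = Unique F × All (λ A → ∣ A ∣ ≡ k) F

Intersecting : {n : ℕ} → List (Subset n) → Set
Intersecting F = ∀ {A B} → A ∈ᴸ F → B ∈ᴸ F → Nonempty (A ∩ B)

UnionIntersecting : {n : ℕ} → ℕ → List (Subset n) → Set
UnionIntersecting t F =
  ∀ A Bs → A ∈ᴸ F → All (_∈ᴸ F) Bs → Unique (A ∷ Bs) → length Bs ≡ t → Nonempty (A ∩ ⋃ Bs)

-- ℓ(F) ≥ γ : every removal of members of F leaving an intersecting family removes ≥ γ members,
-- i.e. every intersecting subfamily G ⊆ F satisfies |F| - |G| ≥ γ.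
ℓ≥ : {n : ℕ} → ℕ → List (Subset n) → Set
ℓ≥ γ F = ∀ G → Unique G → All (_∈ᴸ F) G → Intersecting G → length G + γ ≤ length F

-- Parameters of the construction J^{1,t}_i : distinguished element c (the "1"),
-- x : Fin i → Fin n (the x_j), E, and the families B_j.
record JParams (n i : ℕ) : Set where
  field
    c : Fin n
    x : Fin i → Fin n
    E : Subset n
    B : Fin i → List (Subset n)

module _ {n i : ℕ} (P : JParams n i) where
  open JParams P

  InJset : Fin n → Set
  InJset y = y ≡ c ⊎ ∃ λ j → x j ≡ y

  Aj : Fin i → Subset n
  Aj j = E ∪ ⁅ x j ⁆

  ValidJParams : (k t : ℕ) → Set
  ValidJParams k t =
      (∀ j → x j ≢ c)
    × (∀ j l → x j ≡ x l → j ≡ l)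
    × ∣ E ∣ ≡ k ∸ 1
    × (∀ y → InJset y → y ∉ E)
    × (∀ j → Unique (B j) × length (B j) ≡ t ∸ 1
             × All (λ Bb → ∣ Bb ∣ ≡ k × Empty (Bb ∩ E)
                          × (∀ y → InJset y → ((y ∉ Bb) ⇔' (y ≡ x j))))
                   (B j))
    where
      _⇔'_ : Set → Set → Set
      P₁ ⇔' P₂ = (P₁ → P₂) × (P₂ → P₁)

  InJFamily : (k : ℕ) → Subset n → Set
  InJFamily k A =
      (∣ A ∣ ≡ k × c ∈ A × (∀ j → Nonempty (A ∩ Aj j)))
    ⊎ (∃ λ j → A ≡ Aj j)
    ⊎ (∃ λ j → A ∈ᴸ B j)

image : {n : ℕ} → Permutation′ n → Subset n → Subset n
image σ A = tabulate (λ y → lookup A (σ ⟨$⟩ˡ y))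

IsoToJ : (n k t i : ℕ) → List (Subset n) → Set
IsoToJ n k t i F =
  Σ (JParams n i) λ P → ValidJParams P k t ×
    (∃ λ (σ : Permutation′ n) → ∀ A → (A ∈ᴸ F → InJFamily P k (image σ A))
                                    × (InJFamily P k (image σ A) → A ∈ᴸ F))

bound : (n k t γ : ℕ) → ℕ
bound n k t γ = ((n ∸ 1) C (k ∸ 1)) ∸ ((n ∸ k) C (k ∸ 1)) + ((n ∸ k ∸ γ) C (k ∸ γ ∸ 1)) + γ * t

{-# OPTIONS --safe #-}
-- Since every member of F is disjoint from at most t - 1 others, the members of F containing
-- a set S, apart from at most t - 1 of them, meet any fixed B ∈ F disjoint from S and so
-- contain S ∪ {b} for some b ∈ B. Branching twice shows that, up to O(n^(k-3)) exceptions, every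
-- member of F contains a "heavy" pair, one lying in more than O(n^(k-3)) members. Every heavy
-- pair meets every member of F, and any two heavy pairs meet, so the heavy pairs form a star or
-- a triangle. Fewer than k - 1 of them make F too small; as k ≥ 5 this excludes the triangle and
-- leaves a centre c and a (k-1)-set E of leaves such that every member of F contains c or E.
-- The members avoiding c are then sets E ∪ {x}, and there are m ≥ γ of them. Each x lies outside
-- at most t - 1 of the members that contain c and miss E, and counting the pairs (A , x) with
-- x ∉ A gives the bound for m = γ and a strictly smaller one for m > γ.
module Submission where

open import Defs
open import Data.Nat using (ℕ; zero; suc; _+_; _*_; _∸_; _⊔_; _≤_; _<_; z≤n; s≤s; s≤s⁻¹; _≟_; _≤?_; _<?_; >-nonZero)
open import Data.Nat.Combinatorics using (_C_; nCn≡1; nC1≡n; nCk≡nC[n∸k]; nCk+nC[k+1]≡[n+1]C[k+1])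
open import Data.Nat.ListAction using (sum)
open import Data.Nat.Properties hiding (_≟_; _≤?_; _<?_)
open import Data.Nat.Tactic.RingSolver using (solve-∀)
import Data.Bool as Bool
import Data.Empty as Empty
open import Data.Fin using (Fin; zero; suc)
import Data.Fin.Permutation as Perm
import Data.Fin.Properties as Fin
open import Data.Fin.Subset
open import Data.Fin.Subset.Properties
open import Data.List using (List; []; _∷_; [_]; _++_; length; map; filter; concatMap; take; lookup; allFin)
open import Data.List.Membership.Propositional using (find; lose) renaming (_∈_ to _∈ᴸ_; _∉_ to _∉ᴸ_)
open import Data.List.Membership.Propositional.Properties
open import Data.List.Properties using (length-++; length-map; length-take; length-tabulate)
open import Data.List.Relation.Binary.Subset.Propositional using () renaming (_⊆_ to _⊆ᴸ_)
open import Data.List.Relation.Unary.All as All using (All; []; _∷_)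
import Data.List.Relation.Unary.All.Properties as All
open import Data.List.Relation.Unary.AllPairs as AllPairs using ([]; _∷_)
import Data.List.Relation.Unary.AllPairs.Properties as AllPairs
open import Data.List.Relation.Unary.Any as Any using (here; there)
import Data.List.Relation.Unary.Any.Properties as Any
open import Data.List.Relation.Unary.Unique.Propositional using (Unique)
import Data.List.Relation.Unary.Unique.Propositional.Properties as Unique
open import Data.Product using (∃; _×_; _,_; proj₁; proj₂)
open import Data.Sum as Sum using (_⊎_; inj₁; inj₂; [_,_]′)
open import Data.Vec as Vec using ([]; _∷_; here; there)
import Data.Vec.Properties as Vec
open import Function using (_∘_; id)
open import Relation.Binary.Definitions using (DecidableEquality)
open import Relation.Binary.PropositionalEquality using
  (_≡_; _≢_; refl; sym; trans; cong; cong₂; subst; module ≡-Reasoning)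
open import Relation.Nullary using (¬_; Dec; yes; no; does; contradiction)
open import Relation.Nullary.Decidable using (¬?; _×-dec_; dec-true; decidable-stable)
open import Relation.Unary using (Decidable)

-- Counting in lists

-- The obstacle is that m is bounded only by n - k, so the term m t of the double count can grow
-- with n. For m ≤ t k that term is constant in n. One petal beyond γ lowers C(n-k-γ, k-γ-1) to
-- C(n-k-γ-1, k-γ-2), a drop of C(n-k-γ-1, k-γ-1), which is at least linear in n because γ ≤ k-2.
-- For m > t k a member through c holds at most k-1 petals, hence misses most of them, and at most
-- t-1 members through c that miss E survive. That case is strict because t ≥ 2: for t = 1 the
-- family would be intersecting, against γ ≥ 1. Heavy pairs are counted to leading order. The
-- difference C(n-1,k-1) - C(n-k,k-1) is (k-1) C(n-2,k-2) up to O(n^(k-3)), and one pair lies in at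
-- most C(n-2,k-2) members, so k-2 pairs fall short by a whole C(n-2,k-2). This exceeds any fixed
-- multiple of C(n-3,k-3) once n is large. Every estimate is a sum of separate estimates, so
-- equality in the total gives equality in each, and the parameters of the construction can be read
-- off.

length-⊆ : {A : Set} {xs ys : List A} → Unique xs → xs ⊆ᴸ ys → length xs ≤ length ys
length-⊆ {xs = []} [] xs⊆ys = z≤n
length-⊆ {xs = x ∷ xs} (x∉xs ∷ u) xs⊆ys with ∈-∃++ (xs⊆ys (here refl))
... | as , bs , refl = ≤-trans (s≤s (length-⊆ u xs⊆as++bs)) (≤-reflexive (sym eq))
  where
  eq : length (as ++ x ∷ bs) ≡ suc (length (as ++ bs))
  eq = trans (length-++ as) (trans (+-suc (length as) (length bs)) (cong suc (sym (length-++ as))))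
  xs⊆as++bs : xs ⊆ᴸ as ++ bs
  xs⊆as++bs y∈xs with ∈-++⁻ as (xs⊆ys (there y∈xs))
  ... | inj₁ y∈as = ∈-++⁺ˡ y∈as
  ... | inj₂ (here refl) = contradiction refl (All.lookup x∉xs y∈xs)
  ... | inj₂ (there y∈bs) = ∈-++⁺ʳ as y∈bs

length-≗ : {A : Set} {xs ys : List A} → Unique xs → Unique ys → xs ⊆ᴸ ys → ys ⊆ᴸ xs → length xs ≡ length ys
length-≗ u v p q = ≤-antisym (length-⊆ u p) (length-⊆ v q)

module _ {A : Set} (_≟ᴬ_ : DecidableEquality A) where
  open import Data.List.Membership.DecPropositional _≟ᴬ_ using () renaming (_∈?_ to _∈ᴸ?_)

  -- A missing `y` would make `y ∷ xs` a duplicate-free list inside `ys` and longer than it. In the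
  -- extremal case this turns equality of sizes into equality of families.
  ⊆-length⇒⊇ : {xs ys : List A} → Unique xs → xs ⊆ᴸ ys → length ys ≤ length xs → ys ⊆ᴸ xs
  ⊆-length⇒⊇ {xs} {ys} u xs⊆ys ys≤xs {y} y∈ys with y ∈ᴸ? xs
  ... | yes y∈xs = y∈xs
  ... | no y∉xs = contradiction (≤-trans (length-⊆ y∷u y∷xs⊆ys) ys≤xs) (<-irrefl refl)
    where
    y∷u : Unique (y ∷ xs)
    y∷u = All.¬Any⇒All¬ xs y∉xs ∷ u
    y∷xs⊆ys : y ∷ xs ⊆ᴸ ys
    y∷xs⊆ys (here refl) = y∈ys
    y∷xs⊆ys (there x∈xs) = xs⊆ys x∈xs

length-filter-split : {A : Set} {P : A → Set} (P? : Decidable P) (xs : List A) →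
  length (filter P? xs) + length (filter (¬? ∘ P?) xs) ≡ length xs
length-filter-split P? [] = refl
length-filter-split P? (x ∷ xs) with P? x
... | yes _ = cong suc (length-filter-split P? xs)
... | no _ = trans (+-suc _ _) (cong suc (length-filter-split P? xs))

∑ : {A : Set} → List A → (A → ℕ) → ℕ
∑ xs f = sum (map f xs)

module _ {A : Set} {f g : A → ℕ} where

  ∑-mono : (xs : List A) → (∀ {x} → x ∈ᴸ xs → f x ≤ g x) → ∑ xs f ≤ ∑ xs g
  ∑-mono [] f≤g = z≤n
  ∑-mono (x ∷ xs) f≤g = +-mono-≤ (f≤g (here refl)) (∑-mono xs (f≤g ∘ there))

  -- The slack of a sum is the sum of nonnegative slacks, so a total slack of zero leaves none in
  -- any term. The equality case rests on this.
  ∑-tight : (xs : List A) → (∀ {x} → x ∈ᴸ xs → f x ≤ g x) → ∑ xs g ≤ ∑ xs f →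
    ∀ {x} → x ∈ᴸ xs → g x ≤ f x
  ∑-tight (x ∷ xs) f≤g ∑g≤∑f (here refl) =
    +-cancelʳ-≤ (∑ xs f) (g x) (f x)
      (≤-trans (+-monoʳ-≤ (g x) (∑-mono xs (f≤g ∘ there))) ∑g≤∑f)
  ∑-tight (x ∷ xs) f≤g ∑g≤∑f (there x∈xs) =
    ∑-tight xs (f≤g ∘ there)
      (+-cancelˡ-≤ (f x) (∑ xs g) (∑ xs f) (≤-trans (+-monoˡ-≤ (∑ xs g) (f≤g (here refl))) ∑g≤∑f))
      x∈xs

∑-const : {A : Set} (xs : List A) (c : ℕ) → ∑ xs (λ _ → c) ≡ length xs * c
∑-const [] c = refl
∑-const (x ∷ xs) c = cong (c +_) (∑-const xs c)

∑-bound : {A : Set} {f : A → ℕ} {c : ℕ} (xs : List A) →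
  (∀ {x} → x ∈ᴸ xs → f x ≤ c) → ∑ xs f ≤ length xs * c
∑-bound {c = c} xs f≤c = ≤-trans (∑-mono xs f≤c) (≤-reflexive (∑-const xs c))

length-concatMap : {A B : Set} (f : A → List B) (xs : List A) →
  length (concatMap f xs) ≡ ∑ xs (length ∘ f)
length-concatMap f [] = refl
length-concatMap f (x ∷ xs) =
  trans (length-++ (f x)) (cong (length (f x) +_) (length-concatMap f xs))

-- `f x ⊔ 1` exceeds `f x` by one exactly where `f x` vanishes. With `⊔ 1` every term is at least 1,
-- so the sum bounds the length of the list, and equality there means `f ≤ 1` throughout.
∑-⊔1 : {A : Set} (f : A → ℕ) (xs : List A) →
  ∑ xs (λ x → f x ⊔ 1) ≡ length (filter (λ x → f x ≟ 0) xs) + ∑ xs f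
∑-⊔1 f [] = refl
∑-⊔1 f (x ∷ xs) with f x
... | zero = cong suc (∑-⊔1 f xs)
... | suc m = trans (cong₂ (λ a b → suc (a + b)) (⊔-identityʳ m) (∑-⊔1 f xs)) (rearrange m _ _)
  where
  rearrange : ∀ a b c → suc (a + (b + c)) ≡ b + suc (a + c)
  rearrange = solve-∀

x+[y+z]≡y+[x+z] : ∀ x y z → x + (y + z) ≡ y + (x + z)
x+[y+z]≡y+[x+z] = solve-∀

double-counting : {A B : Set} {R : A → B → Set} (R? : ∀ x y → Dec (R x y)) (xs : List A) (ys : List B) →
  ∑ xs (λ x → length (filter (R? x) ys)) ≡ ∑ ys (λ y → length (filter (λ x → R? x y) xs))
double-counting R? [] ys = sym (trans (∑-const ys 0) (*-zeroʳ (length ys)))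
double-counting {R = R} R? (x ∷ xs) ys =
  trans (cong (length (filter (R? x) ys) +_) (double-counting R? xs ys)) (insert ys)
  where
  insert : ∀ zs → length (filter (R? x) zs) + ∑ zs (λ y → length (filter (λ x → R? x y) xs)) ≡
               ∑ zs (λ y → length (filter (λ x → R? x y) (x ∷ xs)))
  insert [] = refl
  insert (z ∷ zs) with R? x z
  ... | no _ = trans (x+[y+z]≡y+[x+z] p q r) (cong (q +_) (insert zs))
    where
    p = length (filter (R? x) zs)
    q = length (filter (λ x → R? x z) xs)
    r = ∑ zs (λ y → length (filter (λ x → R? x y) xs))
  ... | yes _ = cong suc (trans (x+[y+z]≡y+[x+z] p q r) (cong (q +_) (insert zs)))
    where
    p = length (filter (R? x) zs)
    q = length (filter (λ x → R? x z) xs)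
    r = ∑ zs (λ y → length (filter (λ x → R? x y) xs))

nC0≡1 : ∀ n → n C 0 ≡ 1
nC0≡1 n = trans (nCk≡nC[n∸k] {0} {n} z≤n) (nCn≡1 n)

-- Subsets of a finite set: enumeration, cardinality and intervals

elements : ∀ {n} → Subset n → List (Fin n)
elements [] = []
elements (inside ∷ p) = zero ∷ map suc (elements p)
elements (outside ∷ p) = map suc (elements p)

∈-elements⁺ : ∀ {n} {p : Subset n} {x} → x ∈ p → x ∈ᴸ elements p
∈-elements⁺ here = here refl
∈-elements⁺ {p = inside ∷ p} (there x∈p) = there (∈-map⁺ suc (∈-elements⁺ x∈p))
∈-elements⁺ {p = outside ∷ p} (there x∈p) = ∈-map⁺ suc (∈-elements⁺ x∈p)

∈-elements⁻ : ∀ {n} {p : Subset n} {x} → x ∈ᴸ elements p → x ∈ p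
∈-elements⁻ {p = inside ∷ p} (here refl) = here
∈-elements⁻ {p = inside ∷ p} (there x∈) with ∈-map⁻ suc x∈
... | y , y∈ , refl = there (∈-elements⁻ y∈)
∈-elements⁻ {p = outside ∷ p} x∈ with ∈-map⁻ suc x∈
... | y , y∈ , refl = there (∈-elements⁻ y∈)

elements-unique : ∀ {n} (p : Subset n) → Unique (elements p)
elements-unique [] = []
elements-unique (inside ∷ p) = All.map⁺ (All.tabulate (λ _ ())) ∷ Unique.map⁺ (λ { refl → refl }) (elements-unique p)
elements-unique (outside ∷ p) = Unique.map⁺ (λ { refl → refl }) (elements-unique p)

length-elements : ∀ {n} (p : Subset n) → length (elements p) ≡ ∣ p ∣
length-elements [] = refl
length-elements (inside ∷ p) = cong suc (trans (length-map suc (elements p)) (length-elements p))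
length-elements (outside ∷ p) = trans (length-map suc (elements p)) (length-elements p)

∣∣-unique : ∀ {n} {p : Subset n} {xs} → Unique xs →
  (∀ {x} → x ∈ p → x ∈ᴸ xs) → (∀ {x} → x ∈ᴸ xs → x ∈ p) → ∣ p ∣ ≡ length xs
∣∣-unique {p = p} u p⊆xs xs⊆p = trans (sym (length-elements p))
  (length-≗ (elements-unique p) u (p⊆xs ∘ ∈-elements⁻) (∈-elements⁺ ∘ xs⊆p))

length≤∣∣ : ∀ {n} {p : Subset n} {xs} → Unique xs → (∀ {x} → x ∈ᴸ xs → x ∈ p) → length xs ≤ ∣ p ∣
length≤∣∣ {p = p} u xs⊆p = ≤-trans (length-⊆ u (∈-elements⁺ ∘ xs⊆p)) (≤-reflexive (length-elements p))

∣∣-disjoint-∪ : ∀ {n} {p q : Subset n} → Empty (p ∩ q) → ∣ p ∪ q ∣ ≡ ∣ p ∣ + ∣ q ∣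
∣∣-disjoint-∪ {p = p} {q} p∩q=∅ = trans (∣∣-unique
  (Unique.++⁺ (elements-unique p) (elements-unique q)
    (λ (x∈p , x∈q) → p∩q=∅ (_ , x∈p∩q⁺ (∈-elements⁻ x∈p , ∈-elements⁻ x∈q))))
  (λ x∈ → [ ∈-++⁺ˡ ∘ ∈-elements⁺ , ∈-++⁺ʳ (elements p) ∘ ∈-elements⁺ ]′ (x∈p∪q⁻ p q x∈))
  (λ x∈ → x∈p∪q⁺ ([ inj₁ ∘ ∈-elements⁻ , inj₂ ∘ ∈-elements⁻ ]′ (∈-++⁻ (elements p) x∈))))
  (trans (length-++ (elements p)) (cong₂ _+_ (length-elements p) (length-elements q)))

⊆-∣∣≡⇒≡ : ∀ {n} {p q : Subset n} → p ⊆ q → ∣ q ∣ ≤ ∣ p ∣ → p ≡ q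
⊆-∣∣≡⇒≡ {p = []} {[]} _ _ = refl
⊆-∣∣≡⇒≡ {p = inside ∷ p} {inside ∷ q} s (s≤s l) = cong (inside ∷_) (⊆-∣∣≡⇒≡ (drop-∷-⊆ s) l)
⊆-∣∣≡⇒≡ {p = outside ∷ p} {outside ∷ q} s l = cong (outside ∷_) (⊆-∣∣≡⇒≡ (drop-∷-⊆ s) l)
⊆-∣∣≡⇒≡ {p = inside ∷ p} {outside ∷ q} s l with () ← s here
⊆-∣∣≡⇒≡ {p = outside ∷ p} {inside ∷ q} s l =
  contradiction (≤-trans l (p⊆q⇒∣p∣≤∣q∣ (drop-∷-⊆ s))) (<-irrefl refl)

subset-of-size : ∀ {n} (p : Subset n) {j} → j ≤ ∣ p ∣ → ∃ λ q → q ⊆ p × ∣ q ∣ ≡ j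
subset-of-size {n} p {zero} _ = ⊥ , ⊥⊆ , ∣⊥∣≡0 n
subset-of-size (inside ∷ p) {suc j} (s≤s l) with subset-of-size p l
... | q , q⊆p , refl = inside ∷ q , in⊆in q⊆p , refl
subset-of-size (outside ∷ p) {suc j} l with subset-of-size p l
... | q , q⊆p , eq = outside ∷ q , out⊆ q⊆p , eq

-- The sets A with P ⊆ A ⊆ U and ∣ A ∣ ≡ ∣ P ∣ + j, provided that P ⊆ U.
between : ∀ {n} → Subset n → Subset n → ℕ → List (Subset n)
between [] [] zero = [ [] ]
between [] [] (suc j) = []
between (inside ∷ P) (_ ∷ U) j = map (inside ∷_) (between P U j)
between (outside ∷ P) (outside ∷ U) j = map (outside ∷_) (between P U j)
between (outside ∷ P) (inside ∷ U) zero = map (outside ∷_) (between P U zero)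
between (outside ∷ P) (inside ∷ U) (suc j) =
  map (inside ∷_) (between P U j) ++ map (outside ∷_) (between P U (suc j))

length-between : ∀ {n} {P U : Subset n} j → P ⊆ U → length (between P U j) ≡ (∣ U ∣ ∸ ∣ P ∣) C j
length-between {P = []} {[]} zero _ = refl
length-between {P = []} {[]} (suc j) _ = refl
length-between {P = inside ∷ P} {outside ∷ U} j s with () ← s here
length-between {P = inside ∷ P} {inside ∷ U} j s =
  trans (length-map _ (between P U j)) (length-between j (drop-∷-⊆ s))
length-between {P = outside ∷ P} {outside ∷ U} j s =
  trans (length-map _ (between P U j)) (length-between j (drop-∷-⊆ s))
length-between {P = outside ∷ P} {inside ∷ U} zero s =
  trans (length-map _ (between P U zero)) (trans (length-between zero (drop-∷-⊆ s))
    (trans (nC0≡1 (∣ U ∣ ∸ ∣ P ∣)) (sym (nC0≡1 (suc ∣ U ∣ ∸ ∣ P ∣)))))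
length-between {P = outside ∷ P} {inside ∷ U} (suc j) s = begin
  length (map (inside ∷_) (between P U j) ++ map (outside ∷_) (between P U (suc j)))
    ≡⟨ length-++ (map (inside ∷_) (between P U j)) ⟩
  length (map (inside ∷_) (between P U j)) + length (map (outside ∷_) (between P U (suc j)))
    ≡⟨ cong₂ _+_ (trans (length-map _ (between P U j)) (length-between j P⊆U))
                 (trans (length-map _ (between P U (suc j))) (length-between (suc j) P⊆U)) ⟩
  (∣ U ∣ ∸ ∣ P ∣) C j + (∣ U ∣ ∸ ∣ P ∣) C suc j
    ≡⟨ nCk+nC[k+1]≡[n+1]C[k+1] (∣ U ∣ ∸ ∣ P ∣) j ⟩
  suc (∣ U ∣ ∸ ∣ P ∣) C suc j
    ≡⟨ cong (_C suc j) (sym (+-∸-assoc 1 (p⊆q⇒∣p∣≤∣q∣ P⊆U))) ⟩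
  (suc ∣ U ∣ ∸ ∣ P ∣) C suc j ∎
  where
  open ≡-Reasoning
  P⊆U = drop-∷-⊆ s

∈-between⁺ : ∀ {n} {P U A : Subset n} {j} → P ⊆ A → A ⊆ U → ∣ A ∣ ≡ ∣ P ∣ + j → A ∈ᴸ between P U j
∈-between⁺ {P = []} {[]} {[]} {zero} _ _ _ = here refl
∈-between⁺ {P = inside ∷ P} {_ ∷ U} {outside ∷ A} s _ _ with () ← s here
∈-between⁺ {P = inside ∷ P} {_ ∷ U} {inside ∷ A} s r eq =
  ∈-map⁺ (inside ∷_) (∈-between⁺ (drop-∷-⊆ s) (drop-∷-⊆ r) (suc-injective eq))
∈-between⁺ {P = outside ∷ P} {outside ∷ U} {inside ∷ A} s r _ with () ← r here
∈-between⁺ {P = outside ∷ P} {outside ∷ U} {outside ∷ A} s r eq =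
  ∈-map⁺ (outside ∷_) (∈-between⁺ (drop-∷-⊆ s) (drop-∷-⊆ r) eq)
∈-between⁺ {P = outside ∷ P} {inside ∷ U} {outside ∷ A} {zero} s r eq =
  ∈-map⁺ (outside ∷_) (∈-between⁺ (drop-∷-⊆ s) (drop-∷-⊆ r) eq)
∈-between⁺ {P = outside ∷ P} {inside ∷ U} {outside ∷ A} {suc j} s r eq =
  ∈-++⁺ʳ _ (∈-map⁺ (outside ∷_) (∈-between⁺ (drop-∷-⊆ s) (drop-∷-⊆ r) eq))
∈-between⁺ {P = outside ∷ P} {inside ∷ U} {inside ∷ A} {zero} s r eq =
  contradiction (≤-trans (≤-reflexive (trans eq (+-identityʳ ∣ P ∣))) (p⊆q⇒∣p∣≤∣q∣ (drop-∷-⊆ s))) (<-irrefl refl)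
∈-between⁺ {P = outside ∷ P} {inside ∷ U} {inside ∷ A} {suc j} s r eq =
  ∈-++⁺ˡ (∈-map⁺ (inside ∷_) (∈-between⁺ (drop-∷-⊆ s) (drop-∷-⊆ r) (suc-injective (trans eq (+-suc ∣ P ∣ j)))))

∈-between⁻ : ∀ {n} {P U A : Subset n} j → P ⊆ U → A ∈ᴸ between P U j →
  P ⊆ A × A ⊆ U × ∣ A ∣ ≡ ∣ P ∣ + j
∈-between⁻ {P = []} {[]} zero _ (here refl) = id , id , refl
∈-between⁻ {P = inside ∷ P} {outside ∷ U} j s _ with () ← s here
∈-between⁻ {P = inside ∷ P} {inside ∷ U} j s A∈ with ∈-map⁻ _ A∈
... | A′ , A′∈ , refl with ∈-between⁻ j (drop-∷-⊆ s) A′∈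
...   | a , b , c = in⊆in a , in⊆in b , cong suc c
∈-between⁻ {P = outside ∷ P} {outside ∷ U} j s A∈ with ∈-map⁻ _ A∈
... | A′ , A′∈ , refl with ∈-between⁻ j (drop-∷-⊆ s) A′∈
...   | a , b , c = out⊆ a , out⊆ b , c
∈-between⁻ {P = outside ∷ P} {inside ∷ U} zero s A∈ with ∈-map⁻ _ A∈
... | A′ , A′∈ , refl with ∈-between⁻ zero (drop-∷-⊆ s) A′∈
...   | a , b , c = out⊆ a , out⊆ b , c
∈-between⁻ {P = outside ∷ P} {inside ∷ U} (suc j) s A∈ with ∈-++⁻ (map (inside ∷_) (between P U j)) A∈
∈-between⁻ {P = outside ∷ P} {inside ∷ U} (suc j) s A∈ | inj₁ A∈₁ with ∈-map⁻ _ A∈₁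
... | A′ , A′∈ , refl with ∈-between⁻ j (drop-∷-⊆ s) A′∈
...   | a , b , c = out⊆ a , in⊆in b , trans (cong suc c) (sym (+-suc ∣ P ∣ j))
∈-between⁻ {P = outside ∷ P} {inside ∷ U} (suc j) s A∈ | inj₂ A∈₂ with ∈-map⁻ _ A∈₂
... | A′ , A′∈ , refl with ∈-between⁻ (suc j) (drop-∷-⊆ s) A′∈
...   | a , b , c = out⊆ a , out⊆ b , c

between-unique : ∀ {n} (P U : Subset n) j → Unique (between P U j)
between-unique [] [] zero = [] ∷ []
between-unique [] [] (suc j) = []
between-unique (inside ∷ P) (_ ∷ U) j = Unique.map⁺ Vec.∷-injectiveʳ (between-unique P U j)
between-unique (outside ∷ P) (outside ∷ U) j = Unique.map⁺ Vec.∷-injectiveʳ (between-unique P U j)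
between-unique (outside ∷ P) (inside ∷ U) zero = Unique.map⁺ Vec.∷-injectiveʳ (between-unique P U zero)
between-unique (outside ∷ P) (inside ∷ U) (suc j) =
  Unique.++⁺ (Unique.map⁺ Vec.∷-injectiveʳ (between-unique P U j))
             (Unique.map⁺ Vec.∷-injectiveʳ (between-unique P U (suc j)))
             λ (v∈₁ , v∈₂) → disjoint (∈-map⁻ _ v∈₁) (∈-map⁻ _ v∈₂)
  where
  disjoint : ∀ {n} {v : Subset (suc n)} {xs ys} → (∃ λ a → a ∈ᴸ xs × v ≡ inside ∷ a) →
    (∃ λ b → b ∈ᴸ ys × v ≡ outside ∷ b) → Empty.⊥
  disjoint (_ , _ , refl) (_ , _ , ())

-- Inequalities between binomial coefficients

pascal : ∀ n k → suc n C suc k ≡ n C k + n C suc k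
pascal n k = sym (nCk+nC[k+1]≡[n+1]C[k+1] n k)

C-step : ∀ n k → n C k ≤ suc n C k
C-step n zero = ≤-reflexive (trans (nC0≡1 n) (sym (nC0≡1 (suc n))))
C-step n (suc k) = ≤-trans (m≤n+m (n C suc k) (n C k)) (≤-reflexive (sym (pascal n k)))

C-pos : ∀ {n k} → k ≤ n → 1 ≤ n C k
C-pos {n} z≤n = ≤-reflexive (sym (nC0≡1 n))
C-pos {suc n} {suc k} (s≤s k≤n) =
  ≤-trans (≤-trans (C-pos k≤n) (m≤m+n (n C k) (n C suc k))) (≤-reflexive (sym (pascal n k)))

C-≥ : ∀ {n k} → 1 ≤ k → k < n → n ≤ n C k
C-≥ {suc n} {suc zero} _ _ = ≤-reflexive (sym (nC1≡n (suc n)))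
C-≥ {suc n} {suc (suc k)} _ (s≤s k<n) = begin
  suc n                         ≡⟨ +-comm 1 n ⟩
  n + 1                         ≤⟨ +-mono-≤ (C-≥ (s≤s z≤n) k<n) (C-pos k<n) ⟩
  n C suc k + n C suc (suc k)   ≡⟨ pascal n (suc k) ⟨
  suc n C suc (suc k)           ∎
  where open ≤-Reasoning

C-> : ∀ {n k} → 2 ≤ k → suc k < n → n < n C k
C-> {suc n} {suc k} (s≤s 1≤k) (s≤s k<n) = begin-strict
  suc n               <⟨ s≤s (s≤s ≤-refl) ⟩
  2 + n               ≤⟨ +-monoˡ-≤ n (≤-trans (s≤s 1≤k) (<⇒≤ k<n)) ⟩
  n + n               ≤⟨ +-mono-≤ (C-≥ 1≤k (<-trans (n<1+n k) k<n)) (C-≥ (s≤s z≤n) k<n) ⟩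
  n C k + n C suc k   ≡⟨ pascal n k ⟨
  suc n C suc k       ∎
  where open ≤-Reasoning

-- The absorption identity. It gives C(n-2,k-2) and C(n-3,k-3) the ratio (n-2)/(k-2), which is
-- unbounded in n for fixed k.
C-absorption : ∀ n k → suc k * (suc n C suc k) ≡ suc n * (n C k)
C-absorption n zero = begin
  1 * (suc n C 1)   ≡⟨ *-identityˡ _ ⟩
  suc n C 1         ≡⟨ nC1≡n (suc n) ⟩
  suc n             ≡⟨ *-identityʳ (suc n) ⟨
  suc n * 1         ≡⟨ cong (suc n *_) (nC0≡1 n) ⟨
  suc n * (n C 0)   ∎
  where open ≡-Reasoning
C-absorption zero (suc k) = *-zeroʳ (suc (suc k))
C-absorption (suc n) (suc k) = begin
  suc (suc k) * (suc (suc n) C suc (suc k))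
    ≡⟨ cong (suc (suc k) *_) (pascal (suc n) (suc k)) ⟩
  suc (suc k) * (a + suc n C suc (suc k))
    ≡⟨ *-distribˡ-+ (suc (suc k)) a _ ⟩
  (a + suc k * a) + suc (suc k) * (suc n C suc (suc k))
    ≡⟨ cong₂ (λ x y → (a + x) + y) (C-absorption n k) (C-absorption n (suc k)) ⟩
  (a + suc n * (n C k)) + suc n * (n C suc k)
    ≡⟨ +-assoc a _ _ ⟩
  a + (suc n * (n C k) + suc n * (n C suc k))
    ≡⟨ cong (a +_) (*-distribˡ-+ (suc n) (n C k) (n C suc k)) ⟨
  a + suc n * (n C k + n C suc k)
    ≡⟨ cong (λ x → a + suc n * x) (pascal n k) ⟨
  suc (suc n) * a ∎
  where
  open ≡-Reasoning
  a = suc n C suc k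

-- Each of the `j` Pascal steps from `n` to `j + n` adds some `i C k` with `i` at least `n`. Here
-- every such term is replaced by the smallest, in `C-growth-≤` by the largest.
C-growth-≥ : ∀ n k j → n C suc k + j * (n C k) ≤ (j + n) C suc k
C-growth-≥ n k zero = ≤-reflexive (+-identityʳ (n C suc k))
C-growth-≥ n k (suc j) = begin
  n C suc k + (n C k + j * (n C k))   ≡⟨ x+[y+z]≡y+[x+z] (n C suc k) (n C k) _ ⟩
  n C k + (n C suc k + j * (n C k))   ≤⟨ +-mono-≤ (grow j) (C-growth-≥ n k j) ⟩
  (j + n) C k + (j + n) C suc k       ≡⟨ pascal (j + n) k ⟨
  (suc j + n) C suc k                 ∎
  where
  open ≤-Reasoning
  grow : ∀ i → n C k ≤ (i + n) C k
  grow zero = ≤-refl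
  grow (suc i) = ≤-trans (grow i) (C-step (i + n) k)

C-growth-≤ : ∀ n k j → (suc j + n) C suc k ≤ n C suc k + suc j * ((j + n) C k)
C-growth-≤ n k zero = ≤-reflexive (trans (pascal n k)
  (trans (+-comm (n C k) (n C suc k)) (cong (n C suc k +_) (sym (+-identityʳ (n C k))))))
C-growth-≤ n k (suc j) = begin
  (suc (suc j) + n) C suc k
    ≡⟨ pascal (suc j + n) k ⟩
  (suc j + n) C k + (suc j + n) C suc k
    ≤⟨ +-monoʳ-≤ _ (≤-trans (C-growth-≤ n k j) (+-monoʳ-≤ (n C suc k) (*-monoʳ-≤ (suc j) (C-step (j + n) k)))) ⟩
  (suc j + n) C k + (n C suc k + suc j * ((suc j + n) C k))
    ≡⟨ x+[y+z]≡y+[x+z] ((suc j + n) C k) (n C suc k) _ ⟩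
  n C suc k + suc (suc j) * ((suc j + n) C k) ∎
  where
  open ≤-Reasoning

-- A pair lying in more than heaviness members is heavy; at most light-bound members contain no
-- heavy pair; and too few heavy pairs would force C(n-2,k-2) ≤ ratio * C(n-3,k-3).
heaviness : (n k t : ℕ) → ℕ
heaviness n k t = k * ((n ∸ 3) C (k ∸ 3)) + t

light-bound : (n k t : ℕ) → ℕ
light-bound n k t = k * (k * heaviness n k t + t) + t

ratio : (k t : ℕ) → ℕ
ratio k t = (k * (k * (k + t) + t) + t) + (k ∸ 1) * (k ∸ 2)

-- By `C-growth-≥` the left side is at least (k-1) C(n-k,k-2), and by `C-growth-≤` replacing n-k by
-- n-2 in that binomial costs at most (k-2) C(n-3,k-3) per copy. Cancelling k-2 copies of C(n-2,k-2)
-- leaves one, bounded by `ratio k t` times C(n-3,k-3), and absorption contradicts this for large n.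
-- Writing k as 3 + s and n as k + N removes the truncated subtractions.
few-pairs-too-small-+ : ∀ s t N → let k = 3 + s; n = k + N in
  (k ∸ 2) * ratio k t < n ∸ 2 →
  ¬ ((n ∸ 1) C (k ∸ 1) ∸ N C (k ∸ 1) ≤ (k ∸ 2) * ((n ∸ 2) C (k ∸ 2)) + light-bound n k t)
few-pairs-too-small-+ s t N large small = <-irrefl refl (<-≤-trans large
  (*-cancelʳ-≤ (suc (s + N)) (suc s * ratio k t) c₃ {{>-nonZero c₃-pos}} (begin
    suc (s + N) * c₃            ≡⟨ C-absorption (s + N) s ⟨
    suc s * c₂                  ≤⟨ *-monoʳ-≤ (suc s) c₂≤ ⟩
    suc s * (ratio k t * c₃)    ≡⟨ *-assoc (suc s) (ratio k t) c₃ ⟨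
    suc s * ratio k t * c₃      ∎)))
  where
  open ≤-Reasoning
  k = 3 + s
  c₃ = (s + N) C s
  c₂ = suc (s + N) C suc s
  z = N C suc s
  c₃-pos : 1 ≤ c₃
  c₃-pos = C-pos (m≤m+n s N)
  t≤tc₃ : t ≤ t * c₃
  t≤tc₃ = ≤-trans (≤-reflexive (sym (*-identityʳ t))) (*-monoʳ-≤ t c₃-pos)
  -- One level of branching turns a bound x into k x + t. As `c₃` is at least 1, the additive t also
  -- becomes a multiple of `c₃`; `light-bound` consists of three such levels.
  absorb : ∀ {x} a → x ≤ a * c₃ → k * x + t ≤ (k * a + t) * c₃
  absorb {x} a x≤ = begin
    k * x + t             ≤⟨ +-mono-≤ (*-monoʳ-≤ k x≤) t≤tc₃ ⟩
    k * (a * c₃) + t * c₃ ≡⟨ cong (_+ t * c₃) (sym (*-assoc k a c₃)) ⟩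
    k * a * c₃ + t * c₃   ≡⟨ sym (*-distribʳ-+ c₃ (k * a) t) ⟩
    (k * a + t) * c₃      ∎
  w≤ : k * (k * (k * c₃ + t) + t) + t ≤ (k * (k * (k + t) + t) + t) * c₃
  w≤ = absorb (k * (k + t) + t) (absorb (k + t) (begin
    k * c₃ + t       ≤⟨ +-monoʳ-≤ (k * c₃) t≤tc₃ ⟩
    k * c₃ + t * c₃  ≡⟨ sym (*-distribʳ-+ c₃ k t) ⟩
    (k + t) * c₃     ∎))
  lower : suc (suc s) * z ≤ suc s * c₂ + light-bound (k + N) k t
  lower = ≤-trans (m+n≤o⇒n≤o∸m (N C suc (suc s)) (C-growth-≥ N (suc s) (suc (suc s)))) small
    where
    m+n≤o⇒n≤o∸m : ∀ m {n o} → m + n ≤ o → n ≤ o ∸ m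
    m+n≤o⇒n≤o∸m m {n} {o} le = ≤-trans (≤-reflexive (sym (m+n∸m≡n m n))) (∸-monoˡ-≤ m le)
  c₂≤ : c₂ ≤ ratio k t * c₃
  c₂≤ = +-cancelʳ-≤ (suc s * c₂) c₂ (ratio k t * c₃) (begin
    suc (suc s) * c₂
      ≤⟨ *-monoʳ-≤ (suc (suc s)) (C-growth-≤ N s s) ⟩
    suc (suc s) * (z + suc s * c₃)
      ≡⟨ *-distribˡ-+ (suc (suc s)) z (suc s * c₃) ⟩
    suc (suc s) * z + suc (suc s) * (suc s * c₃)
      ≤⟨ +-mono-≤ (≤-trans lower (+-monoʳ-≤ (suc s * c₂) w≤)) (≤-reflexive (sym (*-assoc (suc (suc s)) (suc s) c₃))) ⟩
    (suc s * c₂ + w * c₃) + suc (suc s) * suc s * c₃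
      ≡⟨ rearrange (suc s * c₂) w (suc (suc s) * suc s) c₃ ⟩
    ratio k t * c₃ + suc s * c₂ ∎)
    where
    w = k * (k * (k + t) + t) + t
    rearrange : ∀ a b c d → (a + b * d) + c * d ≡ (b + c) * d + a
    rearrange = solve-∀

-- Heavy pairs

few-pairs-too-small : ∀ {n k t} → 3 ≤ k → k ≤ n → (k ∸ 2) * ratio k t < n ∸ 2 →
  ¬ ((n ∸ 1) C (k ∸ 1) ∸ (n ∸ k) C (k ∸ 1) ≤ (k ∸ 2) * ((n ∸ 2) C (k ∸ 2)) + light-bound n k t)
few-pairs-too-small {n} {suc (suc (suc s))} {t} (s≤s (s≤s (s≤s _))) k≤n large
  with m≤n⇒∃[o]m+o≡n k≤n
... | N , refl = λ small → few-pairs-too-small-+ s t N large (subst (λ m → (k + N ∸ 1) C (k ∸ 1) ∸ m C (k ∸ 1) ≤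
    (k ∸ 2) * ((k + N ∸ 2) C (k ∸ 2)) + light-bound (k + N) k t) (m+n∸m≡n s N) small)
  where k = 3 + s

⟪_⟫ : ∀ {n} {P : Fin n → Set} → Decidable P → Subset n
⟪ P? ⟫ = Vec.tabulate (does ∘ P?)

∈⟪⟫⁺ : ∀ {n} {P : Fin n → Set} (P? : Decidable P) {x} → P x → x ∈ ⟪ P? ⟫
∈⟪⟫⁺ P? {x} px = Vec.lookup⇒[]= x _ (trans (Vec.lookup∘tabulate (does ∘ P?) x) (dec-true (P? x) px))

∈⟪⟫⁻ : ∀ {n} {P : Fin n → Set} (P? : Decidable P) {x} → x ∈ ⟪ P? ⟫ → P x
∈⟪⟫⁻ P? {x} x∈ with P? x | trans (sym (Vec.lookup∘tabulate (does ∘ P?) x)) (Vec.[]=⇒lookup x∈)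
... | yes px | _ = px

∈-⋃⁻ : ∀ {n} (Bs : List (Subset n)) {x} → x ∈ ⋃ Bs → ∃ λ B → B ∈ᴸ Bs × x ∈ B
∈-⋃⁻ [] x∈ = contradiction x∈ ∉⊥
∈-⋃⁻ (B ∷ Bs) x∈ with x∈p∪q⁻ B (⋃ Bs) x∈
... | inj₁ x∈B = B , here refl , x∈B
... | inj₂ x∈⋃ with ∈-⋃⁻ Bs x∈⋃
...   | B′ , B′∈ , x∈B′ = B′ , there B′∈ , x∈B′

1≤∣∣⇒Nonempty : ∀ {n} {p : Subset n} → 1 ≤ ∣ p ∣ → Nonempty p
1≤∣∣⇒Nonempty {n} {p} 1≤ with nonempty? p
... | yes ne = ne
... | no ¬ne = contradiction (≤-trans 1≤ (≤-reflexive (trans (cong ∣_∣ (Empty-unique ¬ne)) (∣⊥∣≡0 n)))) λ ()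

_at_ : ∀ {n} → List (Subset n) → List (Fin n) → List (Subset n)
G at S = filter (λ A → All.all? (_∈? A) S) G

module _ {n k : ℕ} {F : List (Subset n)} where

  length-at : KFamily n k F → (S : List (Fin n)) → Unique S → length S ≤ k →
    length (F at S) ≤ (n ∸ length S) C (k ∸ length S)
  length-at (uF , kF) S uS S≤k = begin
    length (F at S)                            ≤⟨ length-⊆ (Unique.filter⁺ _ uF) at⊆ ⟩
    length (between P ⊤ (k ∸ length S))        ≡⟨ length-between {P = P} (k ∸ length S) ⊆⊤ ⟩
    (∣ ⊤ {n} ∣ ∸ ∣ P ∣) C (k ∸ length S)       ≡⟨ cong₂ (λ a b → (a ∸ b) C (k ∸ length S)) (∣⊤∣≡n n) ∣P∣ ⟩
    (n ∸ length S) C (k ∸ length S)            ∎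
    where
    open ≤-Reasoning
    open import Data.List.Membership.DecPropositional (Fin._≟_ {n}) using () renaming (_∈?_ to _∈ᴸ?_)
    P = ⟪ _∈ᴸ? S ⟫
    ∣P∣ : ∣ P ∣ ≡ length S
    ∣P∣ = ∣∣-unique uS (∈⟪⟫⁻ (_∈ᴸ? S)) (∈⟪⟫⁺ (_∈ᴸ? S))
    at⊆ : F at S ⊆ᴸ between P ⊤ (k ∸ length S)
    at⊆ {A} A∈ with ∈-filter⁻ (λ A → All.all? (_∈? A) S) A∈
    ... | A∈F , S⊆A = ∈-between⁺ (λ x∈P → All.lookup S⊆A (∈⟪⟫⁻ (_∈ᴸ? S) x∈P)) ⊆⊤
      (trans (All.lookup kF A∈F) (trans (sym (m+[n∸m]≡n S≤k)) (cong (_+ (k ∸ length S)) (sym ∣P∣))))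

disjoint? : ∀ {n} (A B : Subset n) → Dec (Empty (A ∩ B))
disjoint? A B = ¬? (nonempty? (A ∩ B))

module Families {n k t : ℕ} {F : List (Subset n)} (fam : KFamily n k F) (ui : UnionIntersecting t F)
  (1≤k : 1 ≤ k) (1≤t : 1 ≤ t) where

  private
    uF = proj₁ fam
    kF = proj₂ fam

  -- Any `t` members disjoint from `A` would violate `ui`. By `1≤k` the set `A` is nonempty, so it
  -- is not disjoint from itself and the t + 1 sets are distinct.
  few-disjoint : ∀ {A} → A ∈ᴸ F → length (filter (disjoint? A) F) ≤ t ∸ 1
  few-disjoint {A} A∈F with length (filter (disjoint? A) F) ≤? t ∸ 1
  ... | yes le = le
  ... | no ¬le = contradiction (ui A Bs A∈F Bs⊆F (A∉Bs ∷ uBs) ∣Bs∣) disjoint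
    where
    Ds = filter (disjoint? A) F
    Bs = take t Ds
    t≤ : t ≤ length Ds
    t≤ = ≤-trans (≤-reflexive (sym (m+[n∸m]≡n 1≤t))) (≰⇒> ¬le)
    ∣Bs∣ : length Bs ≡ t
    ∣Bs∣ = trans (length-take t Ds) (m≤n⇒m⊓n≡m t≤)
    dis : All (λ B → Empty (A ∩ B)) Bs
    dis = All.take⁺ t (All.all-filter (disjoint? A) F)
    Bs⊆F : All (_∈ᴸ F) Bs
    Bs⊆F = All.take⁺ t (All.filter⁺ (disjoint? A) (All.tabulate id))
    uBs : Unique Bs
    uBs = Unique.take⁺ t (Unique.filter⁺ (disjoint? A) uF)
    A∉Bs : All (A ≢_) Bs
    A∉Bs = All.map (λ { d refl → let x , x∈A = 1≤∣∣⇒Nonempty (subst (1 ≤_) (sym (All.lookup kF A∈F)) 1≤k)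
                                 in d (x , x∈p∩q⁺ (x∈A , x∈A)) }) dis
    disjoint : Empty (A ∩ ⋃ Bs)
    disjoint (x , x∈) with x∈p∩q⁻ A (⋃ Bs) x∈
    ... | x∈A , x∈⋃ with ∈-⋃⁻ Bs x∈⋃
    ...   | B , B∈ , x∈B = All.lookup dis B∈ (x , x∈p∩q⁺ (x∈A , x∈B))

  -- A member of `G` either meets `B`, and then contains one of its points, or is disjoint from it.
  -- `G` may be a proper subfamily while `B` is any member of `F`. The bound gains something only
  -- when `B` misses `S`, since a point b in `S` reproduces the left side.
  branch : ∀ {G B} → Unique G → G ⊆ᴸ F → B ∈ᴸ F → (S : List (Fin n)) →
    length (G at S) ≤ ∑ (elements B) (λ b → length (G at (b ∷ S))) + (t ∸ 1)
  branch {G} {B} uG G⊆F B∈F S = begin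
    length (G at S)                                                  ≤⟨ length-⊆ (Unique.filter⁺ _ uG) at⊆ ⟩
    length (Gs ++ Ds)                                                ≡⟨ length-++ Gs ⟩
    length Gs + length Ds                                            ≤⟨ +-mono-≤ (≤-reflexive (length-concatMap (λ b → G at (b ∷ S)) (elements B))) (few-disjoint B∈F) ⟩
    ∑ (elements B) (λ b → length (G at (b ∷ S))) + (t ∸ 1)           ∎
    where
    open ≤-Reasoning
    Gs = concatMap (λ b → G at (b ∷ S)) (elements B)
    Ds = filter (disjoint? B) F
    at⊆ : G at S ⊆ᴸ Gs ++ Ds
    at⊆ {A} A∈ with ∈-filter⁻ (λ A → All.all? (_∈? A) S) {xs = G} A∈
    ... | A∈G , S⊆A with nonempty? (B ∩ A)
    ...   | no d = ∈-++⁺ʳ Gs (∈-filter⁺ (disjoint? B) (G⊆F A∈G) d)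
    ...   | yes (x , x∈) with x∈p∩q⁻ B A x∈
    ...     | x∈B , x∈A = ∈-++⁺ˡ (∈-concatMap⁺ (λ b → G at (b ∷ S)) (lose (∈-elements⁺ x∈B)
                (∈-filter⁺ (λ A → All.all? (_∈? A) _) A∈G (x∈A ∷ S⊆A))))

  Heavy : Fin n → Fin n → Set
  Heavy a b = heaviness n k t < length (F at (a ∷ b ∷ []))

  heavy? : ∀ a b → Dec (Heavy a b)
  heavy? a b = heaviness n k t <? length (F at (a ∷ b ∷ []))

  heavy-sym : ∀ {a b} → Heavy a b → Heavy b a
  heavy-sym {a} {b} h = <-≤-trans h (length-⊆ (Unique.filter⁺ _ uF) λ {A} A∈ → flip (∈-filter⁻ (λ A → All.all? (_∈? A) _) A∈))
    where
    flip : ∀ {A} → A ∈ᴸ F × All (_∈ A) (a ∷ b ∷ []) → A ∈ᴸ F at (b ∷ a ∷ [])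
    flip (A∈F , a∈A ∷ b∈A ∷ []) = ∈-filter⁺ (λ A → All.all? (_∈? A) _) A∈F (b∈A ∷ a∈A ∷ [])

  unique₂ : ∀ {a b : Fin n} → a ≢ b → Unique (a ∷ b ∷ [])
  unique₂ a≢b = (a≢b ∷ []) ∷ [] ∷ []

  unique₃ : ∀ {a b c : Fin n} → c ≢ a → c ≢ b → a ≢ b → Unique (c ∷ a ∷ b ∷ [])
  unique₃ c≢a c≢b a≢b = (c≢a ∷ c≢b ∷ []) ∷ unique₂ a≢b

  -- The origin of `heaviness`: a member `B` missing both points would, by one branching, leave at
  -- most k C(n-3,k-3) + t members through the pair.
  heavy-covers : 3 ≤ k → ∀ {a b B} → a ≢ b → Heavy a b → B ∈ᴸ F → a ∈ B ⊎ b ∈ B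
  heavy-covers 3≤k {a} {b} {B} a≢b h B∈F with a ∈? B | b ∈? B
  ... | yes a∈B | _ = inj₁ a∈B
  ... | no _ | yes b∈B = inj₂ b∈B
  ... | no a∉B | no b∉B = contradiction (≤-trans h (begin
    length (F at (a ∷ b ∷ []))
      ≤⟨ branch uF id B∈F (a ∷ b ∷ []) ⟩
    ∑ (elements B) (λ x → length (F at (x ∷ a ∷ b ∷ []))) + (t ∸ 1)
      ≤⟨ +-mono-≤ (∑-bound (elements B) λ x∈ → length-at {k = k} fam _
          (unique₃ (λ { refl → a∉B (∈-elements⁻ x∈) }) (λ { refl → b∉B (∈-elements⁻ x∈) }) a≢b) 3≤k)
          (m∸n≤m t 1) ⟩
    length (elements B) * ((n ∸ 3) C (k ∸ 3)) + t
      ≡⟨ cong (λ l → l * ((n ∸ 3) C (k ∸ 3)) + t) (trans (length-elements B) (All.lookup kF B∈F)) ⟩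
    heaviness n k t ∎)) (<-irrefl refl)
    where open ≤-Reasoning

  -- By `heavy-covers` each member through a and b also contains c or d, so there are at most 2
  -- C(n-3,k-3) of them, which is below the threshold.
  heavy-meet : 3 ≤ k → ∀ {a b c d} → a ≢ b → c ≢ d → Heavy a b → Heavy c d →
    c ≢ a → c ≢ b → d ≢ a → d ≢ b → Empty.⊥
  heavy-meet 3≤k {a} {b} {c} {d} a≢b c≢d hab hcd c≢a c≢b d≢a d≢b = <-irrefl refl (≤-trans hab (begin
    length (F at (a ∷ b ∷ []))
      ≤⟨ length-⊆ (Unique.filter⁺ _ uF) at⊆ ⟩
    length (F at (c ∷ a ∷ b ∷ []) ++ F at (d ∷ a ∷ b ∷ []))
      ≡⟨ length-++ (F at (c ∷ a ∷ b ∷ [])) ⟩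
    length (F at (c ∷ a ∷ b ∷ [])) + length (F at (d ∷ a ∷ b ∷ []))
      ≤⟨ +-mono-≤ (length-at {k = k} fam _ (unique₃ c≢a c≢b a≢b) 3≤k) (length-at {k = k} fam _ (unique₃ d≢a d≢b a≢b) 3≤k) ⟩
    c₃ + c₃
      ≡⟨ cong (c₃ +_) (+-identityʳ c₃) ⟨
    2 * c₃
      ≤⟨ *-monoˡ-≤ c₃ (<⇒≤ 3≤k) ⟩
    k * c₃
      ≤⟨ m≤m+n (k * c₃) t ⟩
    heaviness n k t ∎))
    where
    open ≤-Reasoning
    c₃ = (n ∸ 3) C (k ∸ 3)
    at⊆ : F at (a ∷ b ∷ []) ⊆ᴸ F at (c ∷ a ∷ b ∷ []) ++ F at (d ∷ a ∷ b ∷ [])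
    at⊆ A∈ with ∈-filter⁻ (λ A → All.all? (_∈? A) (a ∷ b ∷ [])) {xs = F} A∈
    ... | A∈F , ab⊆A with heavy-covers 3≤k c≢d hcd A∈F
    ...   | inj₁ c∈A = ∈-++⁺ˡ (∈-filter⁺ (λ A → All.all? (_∈? A) _) A∈F (c∈A ∷ ab⊆A))
    ...   | inj₂ d∈A = ∈-++⁺ʳ _ (∈-filter⁺ (λ A → All.all? (_∈? A) _) A∈F (d∈A ∷ ab⊆A))

  -- Members containing a pair from `Q` are counted pair by pair. The others, `G`, contain no heavy
  -- pair, and branching over `A₁` and then over a member avoiding the chosen point reduces them to
  -- light pairs. `Q` has to list each heavy pair in one orientation only.
  heavy-pairs-bound : 3 ≤ k → (Q : List (Fin n × Fin n)) → (∀ {a b} → (a , b) ∈ᴸ Q → a ≢ b) →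
    (∀ {a b} → a ≢ b → Heavy a b → (a , b) ∈ᴸ Q ⊎ (b , a) ∈ᴸ Q) →
    (∀ a → ∃ λ B → B ∈ᴸ F × a ∉ B) → ∀ {A₁} → A₁ ∈ᴸ F →
    length F ≤ length Q * ((n ∸ 2) C (k ∸ 2)) + light-bound n k t
  heavy-pairs-bound 3≤k Q proper captures avoid {A₁} A₁∈F = begin
    length F
      ≡⟨ length-filter-split captured? F ⟨
    length (filter captured? F) + length G
      ≤⟨ +-mono-≤ captured-bound (≤-trans (length-⊆ uG (λ A∈ → ∈-filter⁺ (λ A → All.all? (_∈? A) []) A∈ []))
           (≤-trans (branch uG G⊆F A₁∈F []) (+-mono-≤ (sum-over A₁∈F branch₁) (m∸n≤m t 1)))) ⟩
    length Q * ((n ∸ 2) C (k ∸ 2)) + light-bound n k t ∎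
    where
    open ≤-Reasoning
    captured? = λ A → Any.any? (λ (a , b) → a ∈? A ×-dec b ∈? A) Q
    G = filter (¬? ∘ captured?) F
    uG : Unique G
    uG = Unique.filter⁺ _ uF
    G⊆F : G ⊆ᴸ F
    G⊆F A∈ = proj₁ (∈-filter⁻ (¬? ∘ captured?) A∈)
    captured-bound : length (filter captured? F) ≤ length Q * ((n ∸ 2) C (k ∸ 2))
    captured-bound = begin
      length (filter captured? F)
        ≤⟨ length-⊆ {ys = concatMap (λ (a , b) → F at (a ∷ b ∷ [])) Q} (Unique.filter⁺ captured? uF)
             (λ A∈ → let A∈F , c = ∈-filter⁻ captured? {xs = F} A∈ in
             ∈-concatMap⁺ (λ (a , b) → F at (a ∷ b ∷ [])) (Any.map (λ (a∈A , b∈A) →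
               ∈-filter⁺ (λ A → All.all? (_∈? A) _) A∈F (a∈A ∷ b∈A ∷ [])) c)) ⟩
      length (concatMap (λ (a , b) → F at (a ∷ b ∷ [])) Q)
        ≡⟨ length-concatMap (λ (a , b) → F at (a ∷ b ∷ [])) Q ⟩
      ∑ Q (λ (a , b) → length (F at (a ∷ b ∷ [])))
        ≤⟨ ∑-bound Q (λ ab∈ → length-at {k = k} fam _ (unique₂ (proper ab∈)) (<⇒≤ 3≤k)) ⟩
      length Q * ((n ∸ 2) C (k ∸ 2)) ∎
    sum-over : ∀ {A f c} → A ∈ᴸ F → (∀ {x} → x ∈ A → f x ≤ c) → ∑ (elements A) f ≤ k * c
    sum-over {A} {c = c} A∈F f≤c = ≤-trans (∑-bound (elements A) (λ x∈ → f≤c (∈-elements⁻ x∈)))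
      (≤-reflexive (cong (_* c) (trans (length-elements A) (All.lookup kF A∈F))))
    branch₂ : ∀ {a b} → b ≢ a → length (G at (b ∷ a ∷ [])) ≤ heaviness n k t
    branch₂ {a} {b} b≢a with heavy? b a
    ... | no ¬h = ≤-trans (length-⊆ (Unique.filter⁺ _ uG) (λ A∈ →
            let A∈G , ba⊆A = ∈-filter⁻ (λ A → All.all? (_∈? A) _) {xs = G} A∈ in
            ∈-filter⁺ (λ A → All.all? (_∈? A) _) (G⊆F A∈G) ba⊆A)) (≮⇒≥ ¬h)
    -- A heavy pair occurs in `Q`, so all members through it were captured and none is left in `G`.
    ... | yes h = ≤-trans (length-⊆ {ys = []} (Unique.filter⁺ _ uG) (λ A∈ → contradiction A∈ none)) z≤n
      where
      none : ∀ {A} → A ∉ᴸ G at (b ∷ a ∷ [])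
      none A∈ with ∈-filter⁻ (λ A → All.all? (_∈? A) (b ∷ a ∷ [])) {xs = G} A∈
      ... | A∈G , b∈A ∷ a∈A ∷ [] = proj₂ (∈-filter⁻ (¬? ∘ captured?) {xs = F} A∈G)
        ([ (λ q → lose q (b∈A , a∈A)) , (λ q → lose q (a∈A , b∈A)) ]′ (captures b≢a h))
    branch₁ : ∀ {a} → a ∈ A₁ → length (G at (a ∷ [])) ≤ k * heaviness n k t + t
    branch₁ {a} _ with avoid a
    -- The second branching set must miss `a`, or the branch at `a` itself would add no new point.
    ... | B , B∈F , a∉B = ≤-trans (branch uG G⊆F B∈F (a ∷ []))
      (+-mono-≤ (sum-over B∈F (λ b∈B → branch₂ (λ { refl → a∉B b∈B }))) (m∸n≤m t 1))

  -- Only the members avoiding the centre `c` share the kernel `E`. As `E` has k-1 points, each of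
  -- them is `E` plus a single petal.
  Sunflower : Fin n → Subset n → Set
  Sunflower c E = ∣ E ∣ ≡ k ∸ 1 × c ∉ E × (∀ {A} → A ∈ᴸ F → c ∈ A ⊎ E ⊆ A)

  sunflower : 5 ≤ k → k ≤ n → (k ∸ 2) * ratio k t < n ∸ 2 →
    (n ∸ 1) C (k ∸ 1) ∸ (n ∸ k) C (k ∸ 1) ≤ length F →
    (∀ a → ∃ λ B → B ∈ᴸ F × a ∉ B) → ∀ {A₁} → A₁ ∈ᴸ F →
    ∃ λ c → ∃ λ E → Sunflower c E
  sunflower 5≤k k≤n large big avoid A₁∈F = search
    where
    3≤k : 3 ≤ k
    3≤k = ≤-trans (s≤s (s≤s (s≤s z≤n))) 5≤k

    many-pairs : (Q : List (Fin n × Fin n)) → (∀ {a b} → (a , b) ∈ᴸ Q → a ≢ b) →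
      (∀ {a b} → a ≢ b → Heavy a b → (a , b) ∈ᴸ Q ⊎ (b , a) ∈ᴸ Q) → ¬ (length Q ≤ k ∸ 2)
    many-pairs Q proper captures Q≤ = few-pairs-too-small {n} {k} {t} 3≤k k≤n large
      (≤-trans big (≤-trans (heavy-pairs-bound 3≤k Q proper captures avoid A₁∈F)
        (+-monoˡ-≤ (light-bound n k t) (*-monoˡ-≤ ((n ∸ 2) C (k ∸ 2)) Q≤))))

    module _ (c : Fin n) where

      leaf? : ∀ y → Dec (c ≢ y × Heavy c y)
      leaf? y = ¬? (c Fin.≟ y) ×-dec heavy? c y

      leaves : Subset n
      leaves = ⟪ leaf? ⟫

      -- A member without `c` must contain every leaf, by `heavy-covers`, so any k-1 leaves serve as
      -- kernel. With fewer leaves the heavy pairs are too few for the size of `F`.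
      star : (∀ {a b} → a ≢ b → Heavy a b → a ≡ c ⊎ b ≡ c) → ∃ λ c → ∃ λ E → Sunflower c E
      star central with k ∸ 1 ≤? ∣ leaves ∣
      ... | yes k-1≤ with subset-of-size leaves k-1≤
      ...   | E , E⊆leaves , ∣E∣ = c , E , ∣E∣ , (λ c∈ → proj₁ (∈⟪⟫⁻ leaf? (E⊆leaves c∈)) refl) , cover
        where
        cover : ∀ {A} → A ∈ᴸ F → c ∈ A ⊎ E ⊆ A
        cover {A} A∈F with c ∈? A
        ... | yes c∈A = inj₁ c∈A
        ... | no c∉A = inj₂ λ y∈ → let c≢y , h = ∈⟪⟫⁻ leaf? (E⊆leaves y∈) in
          [ (λ c∈A → contradiction c∈A c∉A) , id ]′ (heavy-covers 3≤k c≢y h A∈F)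
      star central | no k-1≰ = contradiction
        (≤-trans (≤-reflexive (trans (length-map (c ,_) (elements leaves)) (length-elements leaves)))
          (s≤s⁻¹ (≤-trans (≰⇒> k-1≰) (≤-reflexive (+-∸-assoc 1 (≤-trans (s≤s (s≤s z≤n)) 5≤k))))))
        (many-pairs (map (c ,_) (elements leaves)) proper captures)
        where
        proper : ∀ {a b} → (a , b) ∈ᴸ map (c ,_) (elements leaves) → a ≢ b
        proper ab∈ with ∈-map⁻ (c ,_) ab∈
        ... | b , b∈ , refl = proj₁ (∈⟪⟫⁻ leaf? (∈-elements⁻ b∈))
        captures : ∀ {a b} → a ≢ b → Heavy a b →
          (a , b) ∈ᴸ map (c ,_) (elements leaves) ⊎ (b , a) ∈ᴸ map (c ,_) (elements leaves)
        captures a≢b h with central a≢b h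
        ... | inj₁ refl = inj₁ (∈-map⁺ (c ,_) (∈-elements⁺ (∈⟪⟫⁺ leaf? (a≢b , h))))
        ... | inj₂ refl = inj₂ (∈-map⁺ (c ,_) (∈-elements⁺ (∈⟪⟫⁺ leaf? (a≢b ∘ sym , heavy-sym h))))

    -- A heavy pair that is not a side has at most one point among a, b, c and so misses a whole
    -- side, against `heavy-meet`. Hence the three sides are all the heavy pairs, and 3 ≤ k - 2
    -- contradicts `many-pairs`.
    triangle : ∀ {a b c} → a ≢ b → b ≢ c → a ≢ c → Heavy a b → Heavy b c → Heavy a c → Empty.⊥
    triangle {a} {b} {c} a≢b b≢c a≢c hab hbc hac =
      many-pairs Q proper captures (∸-monoˡ-≤ 2 5≤k)
      where
      Q = (a , b) ∷ (b , c) ∷ (a , c) ∷ []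
      proper : ∀ {p q} → (p , q) ∈ᴸ Q → p ≢ q
      proper (here refl) = a≢b
      proper (there (here refl)) = b≢c
      proper (there (there (here refl))) = a≢c
      captures : ∀ {p q} → p ≢ q → Heavy p q → (p , q) ∈ᴸ Q ⊎ (q , p) ∈ᴸ Q
      captures {p} {q} p≢q h with p Fin.≟ a | p Fin.≟ b | p Fin.≟ c | q Fin.≟ a | q Fin.≟ b | q Fin.≟ c
      ... | yes refl | _ | _ | yes refl | _ | _ = contradiction refl p≢q
      ... | yes refl | _ | _ | _ | yes refl | _ = inj₁ (here refl)
      ... | yes refl | _ | _ | _ | _ | yes refl = inj₁ (there (there (here refl)))
      ... | yes refl | _ | _ | no _ | no q≢b | no q≢c =
        contradiction h λ h → heavy-meet 3≤k b≢c p≢q hbc h a≢b a≢c q≢b q≢c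
      ... | _ | yes refl | _ | yes refl | _ | _ = inj₂ (here refl)
      ... | _ | yes refl | _ | _ | yes refl | _ = contradiction refl p≢q
      ... | _ | yes refl | _ | _ | _ | yes refl = inj₁ (there (here refl))
      ... | _ | yes refl | _ | no q≢a | no _ | no q≢c =
        contradiction h λ h → heavy-meet 3≤k a≢c p≢q hac h (a≢b ∘ sym) b≢c q≢a q≢c
      ... | _ | _ | yes refl | yes refl | _ | _ = inj₂ (there (there (here refl)))
      ... | _ | _ | yes refl | _ | yes refl | _ = inj₂ (there (here refl))
      ... | _ | _ | yes refl | _ | _ | yes refl = contradiction refl p≢q
      ... | _ | _ | yes refl | no q≢a | no q≢b | no _ =
        contradiction h λ h → heavy-meet 3≤k a≢b p≢q hab h (a≢c ∘ sym) (b≢c ∘ sym) q≢a q≢b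
      ... | no _ | no p≢b | no p≢c | yes refl | _ | _ =
        contradiction h λ h → heavy-meet 3≤k b≢c p≢q hbc h p≢b p≢c a≢b a≢c
      ... | no p≢a | no p≢b | no p≢c | no q≢a | yes refl | _ =
        contradiction h λ h → heavy-meet 3≤k a≢c p≢q hac h p≢a p≢c (a≢b ∘ sym) b≢c
      ... | no p≢a | no p≢b | no p≢c | no q≢a | no q≢b | _ =
        contradiction h λ h → heavy-meet 3≤k a≢b p≢q hab h p≢a p≢b q≢a q≢b

    missing? : ∀ c → Dec (∃ λ y → ∃ λ z → y ≢ z × Heavy y z × y ≢ c × z ≢ c)
    missing? c = Fin.any? λ y → Fin.any? λ z →
      ¬? (y Fin.≟ z) ×-dec heavy? y z ×-dec ¬? (y Fin.≟ c) ×-dec ¬? (z Fin.≟ c)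

    star-unless : ∀ c → ¬ (∃ λ y → ∃ λ z → y ≢ z × Heavy y z × y ≢ c × z ≢ c) → ∃ λ c → ∃ λ E → Sunflower c E
    star-unless c ¬missing = star c λ {a} {b} a≢b h → central a b a≢b h
      where
      central : ∀ a b → a ≢ b → Heavy a b → a ≡ c ⊎ b ≡ c
      central a b a≢b h with a Fin.≟ c | b Fin.≟ c
      ... | yes eq | _ = inj₁ eq
      ... | no _ | yes eq = inj₂ eq
      ... | no a≢c | no b≢c = contradiction (a , b , a≢b , h , a≢c , b≢c) ¬missing

    -- A heavy pair missing a still meets {a , b}, hence contains b.
    through : ∀ {a b} → a ≢ b → Heavy a b → (∃ λ y → ∃ λ z → y ≢ z × Heavy y z × y ≢ a × z ≢ a) →
      ∃ λ z → z ≢ a × b ≢ z × Heavy b z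
    through {a} {b} a≢b hab (y , z , y≢z , h , y≢a , z≢a) with y Fin.≟ b | z Fin.≟ b
    ... | yes refl | _ = z , z≢a , y≢z , h
    ... | no _ | yes refl = y , y≢a , y≢z ∘ sym , heavy-sym h
    ... | no y≢b | no z≢b = contradiction h λ h → heavy-meet 3≤k a≢b y≢z hab h y≢a y≢b z≢a z≢b

    -- Fix a heavy pair a, b. If no heavy pair misses a, or none misses b, there is a star.
    -- Otherwise `through` yields heavy pairs b, z and a, w, which must meet; this forces w = z and
    -- closes a triangle.
    search : ∃ λ c → ∃ λ E → Sunflower c E
    search with Fin.any? (λ a → Fin.any? (λ b → ¬? (a Fin.≟ b) ×-dec heavy? a b))
    ... | no ¬heavy = contradiction z≤n
      (many-pairs [] (λ ()) (λ a≢b h → contradiction (_ , _ , a≢b , h) ¬heavy))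
    ... | yes (a , b , a≢b , hab) with missing? a
    ...   | no ¬m = star-unless a ¬m
    ...   | yes ma with missing? b
    ...     | no ¬m = star-unless b ¬m
    ...     | yes mb with through a≢b hab ma | through (a≢b ∘ sym) (heavy-sym hab) mb
    ...       | z , z≢a , b≢z , hbz | w , w≢b , a≢w , haw with w Fin.≟ z
    ...         | yes refl = contradiction haw (triangle a≢b b≢z a≢w hab hbz)
    ...         | no w≢z = contradiction haw λ h → heavy-meet 3≤k b≢z a≢w hbz h a≢b (z≢a ∘ sym) w≢b w≢z

-- Families determined by the centre c and the kernel E

∩-∅⇒⊆∁ : ∀ {n} {A E : Subset n} → Empty (A ∩ E) → A ⊆ ∁ E
∩-∅⇒⊆∁ d x∈A = x∉p⇒x∈∁p (λ x∈E → d (_ , x∈p∩q⁺ (x∈A , x∈E)))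

⊆∁⇒∩-∅ : ∀ {n} {A E : Subset n} → A ⊆ ∁ E → Empty (A ∩ E)
⊆∁⇒∩-∅ {A = A} {E} A⊆ (x , x∈) with x∈p∩q⁻ A E x∈
... | x∈A , x∈E = x∈∁p⇒x∉p (A⊆ x∈A) x∈E

⁅⁆⊆ : ∀ {n} {c : Fin n} {A} → c ∈ A → ⁅ c ⁆ ⊆ A
⁅⁆⊆ {c = c} {A} c∈A x∈ = subst (_∈ A) (sym (x∈⁅y⁆⇒x≡y c x∈)) c∈A

∪-⊆ : ∀ {n} {p q r : Subset n} → p ⊆ r → q ⊆ r → p ∪ q ⊆ r
∪-⊆ {p = p} {q} p⊆r q⊆r x∈ = [ p⊆r , q⊆r ]′ (x∈p∪q⁻ p q x∈)

∣⁅c⁆∪Y∣ : ∀ {n} {c : Fin n} {Y : Subset n} → c ∉ Y → ∣ ⁅ c ⁆ ∪ Y ∣ ≡ suc ∣ Y ∣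
∣⁅c⁆∪Y∣ {c = c} {Y} c∉Y = trans (∣∣-disjoint-∪ dis) (cong (_+ ∣ Y ∣) (∣⁅x⁆∣≡1 c))
  where
  dis : Empty (⁅ c ⁆ ∩ Y)
  dis (x , x∈) with x∈p∩q⁻ ⁅ c ⁆ Y x∈
  ... | x∈c , x∈Y = c∉Y (subst (_∈ Y) (x∈⁅y⁆⇒x≡y c x∈c) x∈Y)

∣E∪⁅x⁆∣ : ∀ {n} {x : Fin n} {E : Subset n} → x ∉ E → ∣ E ∪ ⁅ x ⁆ ∣ ≡ suc ∣ E ∣
∣E∪⁅x⁆∣ {x = x} {E} x∉E = trans (cong ∣_∣ (∪-comm E ⁅ x ⁆)) (∣⁅c⁆∪Y∣ x∉E)

module Kernel {n k : ℕ} {c : Fin n} {E : Subset n} (1≤k : 1 ≤ k) (∣E∣ : ∣ E ∣ ≡ k ∸ 1) (c∉E : c ∉ E) where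

  1+[k-1] : suc (k ∸ 1) ≡ k
  1+[k-1] = m+[n∸m]≡n 1≤k

  -- These sets avoid the kernel `E`. For a `Y` of γ points their number is the last binomial
  -- coefficient in `bound`.
  avoiders : Subset n → List (Subset n)
  avoiders Y = between (⁅ c ⁆ ∪ Y) (∁ E) (k ∸ suc ∣ Y ∣)

  private
    c∪Y⊆∁E : ∀ {Y} → Empty (Y ∩ E) → ⁅ c ⁆ ∪ Y ⊆ ∁ E
    c∪Y⊆∁E Y∩E=∅ = ∪-⊆ (⁅⁆⊆ (x∉p⇒x∈∁p c∉E)) (∩-∅⇒⊆∁ Y∩E=∅)

  length-avoiders : ∀ {Y} → c ∉ Y → Empty (Y ∩ E) →
    length (avoiders Y) ≡ (n ∸ k ∸ ∣ Y ∣) C (k ∸ ∣ Y ∣ ∸ 1)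
  length-avoiders {Y} c∉Y Y∩E=∅ = trans (length-between {P = ⁅ c ⁆ ∪ Y} (k ∸ suc ∣ Y ∣) (c∪Y⊆∁E Y∩E=∅)) (cong₂ _C_ top bottom)
    where
    open ≡-Reasoning
    top : ∣ ∁ E ∣ ∸ ∣ ⁅ c ⁆ ∪ Y ∣ ≡ n ∸ k ∸ ∣ Y ∣
    top = begin
      ∣ ∁ E ∣ ∸ ∣ ⁅ c ⁆ ∪ Y ∣          ≡⟨ cong₂ _∸_ (trans (∣∁p∣≡n∸∣p∣ E) (cong (n ∸_) ∣E∣)) (∣⁅c⁆∪Y∣ c∉Y) ⟩
      n ∸ (k ∸ 1) ∸ suc ∣ Y ∣          ≡⟨ ∸-+-assoc n (k ∸ 1) (suc ∣ Y ∣) ⟩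
      n ∸ (k ∸ 1 + suc ∣ Y ∣)          ≡⟨ cong (n ∸_) (trans (+-suc (k ∸ 1) ∣ Y ∣) (cong (_+ ∣ Y ∣) 1+[k-1])) ⟩
      n ∸ (k + ∣ Y ∣)                  ≡⟨ ∸-+-assoc n k ∣ Y ∣ ⟨
      n ∸ k ∸ ∣ Y ∣                    ∎
    bottom : k ∸ suc ∣ Y ∣ ≡ k ∸ ∣ Y ∣ ∸ 1
    bottom = trans (cong (k ∸_) (+-comm 1 ∣ Y ∣)) (sym (∸-+-assoc k ∣ Y ∣ 1))

  ∈-avoiders⁺ : ∀ {Y A} → c ∉ Y → ∣ Y ∣ < k → ∣ A ∣ ≡ k → c ∈ A → Y ⊆ A → Empty (A ∩ E) → A ∈ᴸ avoiders Y
  ∈-avoiders⁺ {Y} c∉Y Y<k ∣A∣ c∈A Y⊆A A∩E=∅ = ∈-between⁺ (∪-⊆ (⁅⁆⊆ c∈A) Y⊆A) (∩-∅⇒⊆∁ A∩E=∅)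
    (trans ∣A∣ (trans (sym (m+[n∸m]≡n Y<k)) (cong (_+ (k ∸ suc ∣ Y ∣)) (sym (∣⁅c⁆∪Y∣ c∉Y)))))

  ∈-avoiders⁻ : ∀ {Y A} → c ∉ Y → Empty (Y ∩ E) → ∣ Y ∣ < k → A ∈ᴸ avoiders Y →
    ∣ A ∣ ≡ k × c ∈ A × Y ⊆ A × Empty (A ∩ E)
  ∈-avoiders⁻ {Y} c∉Y Y∩E=∅ Y<k A∈ with ∈-between⁻ (k ∸ suc ∣ Y ∣) (c∪Y⊆∁E Y∩E=∅) A∈
  ... | P⊆A , A⊆ , ∣A∣ = trans ∣A∣ (trans (cong (_+ (k ∸ suc ∣ Y ∣)) (∣⁅c⁆∪Y∣ c∉Y)) (m+[n∸m]≡n Y<k)) ,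
    P⊆A (p⊆p∪q Y (x∈⁅x⁆ c)) , (λ x∈Y → P⊆A (q⊆p∪q ⁅ c ⁆ Y x∈Y)) , ⊆∁⇒∩-∅ A⊆

  private
    star = between ⁅ c ⁆ ⊤ (k ∸ 1)
    hits? = λ A → nonempty? (A ∩ E)

    ∈-star⁺ : ∀ {A} → ∣ A ∣ ≡ k → c ∈ A → A ∈ᴸ star
    ∈-star⁺ ∣A∣ c∈A = ∈-between⁺ (⁅⁆⊆ c∈A) ⊆⊤
      (trans ∣A∣ (trans (sym 1+[k-1]) (cong (_+ (k ∸ 1)) (sym (∣⁅x⁆∣≡1 c)))))

    ∈-star⁻ : ∀ {A} → A ∈ᴸ star → ∣ A ∣ ≡ k × c ∈ A
    ∈-star⁻ A∈ with ∈-between⁻ (k ∸ 1) (⊆⊤ {p = ⁅ c ⁆}) A∈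
    ... | c⊆A , _ , ∣A∣ = trans ∣A∣ (trans (cong (_+ (k ∸ 1)) (∣⁅x⁆∣≡1 c)) 1+[k-1]) , c⊆A (x∈⁅x⁆ c)

  hitters : List (Subset n)
  hitters = filter hits? star

  hitters-unique : Unique hitters
  hitters-unique = Unique.filter⁺ hits? (between-unique ⁅ c ⁆ ⊤ (k ∸ 1))

  ∈-hitters⁺ : ∀ {A} → ∣ A ∣ ≡ k → c ∈ A → Nonempty (A ∩ E) → A ∈ᴸ hitters
  ∈-hitters⁺ ∣A∣ c∈A hit = ∈-filter⁺ hits? (∈-star⁺ ∣A∣ c∈A) hit

  ∈-hitters⁻ : ∀ {A} → A ∈ᴸ hitters → ∣ A ∣ ≡ k × c ∈ A × Nonempty (A ∩ E)
  ∈-hitters⁻ A∈ with ∈-filter⁻ hits? {xs = star} A∈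
  ... | A∈star , hit with ∈-star⁻ A∈star
  ...   | ∣A∣ , c∈A = ∣A∣ , c∈A , hit

  -- The sets through `c` that miss `E` lie in the complement of `E`, which has n-k points besides
  -- `c`.
  length-hitters : length hitters ≡ (n ∸ 1) C (k ∸ 1) ∸ (n ∸ k) C (k ∸ 1)
  length-hitters = trans (sym (m+n∸n≡m (length hitters) (length missers)))
    (cong₂ _∸_ (trans (length-filter-split hits? star) length-star) length-missers)
    where
    missers = filter (¬? ∘ hits?) star
    length-star : length star ≡ (n ∸ 1) C (k ∸ 1)
    length-star = trans (length-between {P = ⁅ c ⁆} (k ∸ 1) ⊆⊤)
      (cong₂ (λ a b → (a ∸ b) C (k ∸ 1)) (∣⊤∣≡n n) (∣⁅x⁆∣≡1 c))
    c⊆∁E : ⁅ c ⁆ ⊆ ∁ E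
    c⊆∁E = ⁅⁆⊆ (x∉p⇒x∈∁p c∉E)
    missers⊆ : missers ⊆ᴸ between ⁅ c ⁆ (∁ E) (k ∸ 1)
    missers⊆ A∈ with ∈-filter⁻ (¬? ∘ hits?) {xs = star} A∈
    ... | A∈star , miss with ∈-between⁻ (k ∸ 1) (⊆⊤ {p = ⁅ c ⁆}) A∈star
    ...   | c⊆A , _ , ∣A∣ = ∈-between⁺ c⊆A (∩-∅⇒⊆∁ miss) ∣A∣
    ⊆missers : between ⁅ c ⁆ (∁ E) (k ∸ 1) ⊆ᴸ missers
    ⊆missers A∈ with ∈-between⁻ (k ∸ 1) c⊆∁E A∈
    ... | c⊆A , A⊆ , ∣A∣ = ∈-filter⁺ (¬? ∘ hits?) (∈-between⁺ c⊆A ⊆⊤ ∣A∣) (⊆∁⇒∩-∅ A⊆)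
    length-missers : length missers ≡ (n ∸ k) C (k ∸ 1)
    length-missers = trans (length-≗ (Unique.filter⁺ (¬? ∘ hits?) (between-unique ⁅ c ⁆ ⊤ (k ∸ 1)))
        (between-unique ⁅ c ⁆ (∁ E) (k ∸ 1)) missers⊆ ⊆missers)
      (trans (length-between {P = ⁅ c ⁆} (k ∸ 1) c⊆∁E) (cong (_C (k ∸ 1)) (begin
        ∣ ∁ E ∣ ∸ ∣ ⁅ c ⁆ ∣   ≡⟨ cong₂ _∸_ (trans (∣∁p∣≡n∸∣p∣ E) (cong (n ∸_) ∣E∣)) (∣⁅x⁆∣≡1 c) ⟩
        n ∸ (k ∸ 1) ∸ 1       ≡⟨ ∸-+-assoc n (k ∸ 1) 1 ⟩
        n ∸ (k ∸ 1 + 1)       ≡⟨ cong (n ∸_) (trans (+-comm (k ∸ 1) 1) 1+[k-1]) ⟩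
        n ∸ k                 ∎)))
      where open ≡-Reasoning

-- Counting around a kernel

-- By Pascal the two binomials differ by `M C J`, which is at least `M` and so outweighs `m * t`.
-- This is the comparison for γ < m ≤ t k.
drop-one : ∀ {M J} m γ t → 1 ≤ J → J < M → m * t < M → M C (J ∸ 1) + m * t < suc M C J + γ * t
drop-one {M} {suc j} m γ t _ j<M mt<M = begin-strict
  M C j + m * t          <⟨ +-monoʳ-< (M C j) (<-≤-trans mt<M (C-≥ (s≤s z≤n) j<M)) ⟩
  M C j + M C suc j      ≡⟨ pascal M j ⟨
  suc M C suc j          ≤⟨ m≤m+n (suc M C suc j) (γ * t) ⟩
  suc M C suc j + γ * t  ∎
  where open ≤-Reasoning

-- With γ = 1 + β, the right side less the left is `M C J` - M + (γ-1)(t-1). For γ at least 2 the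
-- product is positive and `M C J` ≥ M suffices. For γ = 1 it vanishes, so `M C J` must exceed M,
-- which takes J ≥ 2.
few-stray : ∀ {M J} β t → 2 ≤ t → 1 ≤ J → (β ≡ 0 → 2 ≤ J) → suc J < M →
  (t ∸ 1) + (M + suc β) < M C J + suc β * t
few-stray {M} {J} zero (suc t) _ _ J≥2 J<M = begin-strict
  t + (M + 1)           ≡⟨ +-comm t (M + 1) ⟩
  (M + 1) + t           ≡⟨ +-assoc M 1 t ⟩
  M + suc t             <⟨ +-monoˡ-< (suc t) (C-> (J≥2 refl) J<M) ⟩
  M C J + suc t         ≡⟨ cong (M C J +_) (+-identityʳ (suc t)) ⟨
  M C J + 1 * suc t     ∎
  where open ≤-Reasoning
few-stray (suc β) (suc zero) (s≤s ())
few-stray {M} {J} (suc β) (suc (suc t)) _ 1≤J _ J<M = begin-strict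
  suc t + (M + suc (suc β))                ≡⟨ rearrange t M β ⟩
  M + suc (suc (suc t) + β * 1)            ≤⟨ +-mono-≤ (C-≥ 1≤J (<-trans (n<1+n J) J<M)) (+-monoʳ-≤ (suc (suc (suc t))) (*-monoʳ-≤ β (s≤s (z≤n {suc t})))) ⟩
  M C J + suc (suc (suc t) + β * suc (suc t)) <⟨ +-monoʳ-< (M C J) (≤-trans (m≤m+n _ t) (≤-reflexive (rearrange₂ t (β * suc (suc t))))) ⟩
  M C J + suc (suc β) * suc (suc t)        ∎
  where
  open ≤-Reasoning
  rearrange : ∀ t M β → suc t + (M + suc (suc β)) ≡ M + suc (suc (suc t) + β * 1)
  rearrange = solve-∀
  rearrange₂ : ∀ t b → suc (suc (suc (suc t) + b)) + t ≡ suc (suc t) + (suc (suc t) + b)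
  rearrange₂ = solve-∀

m+m*[t-1] : ∀ m {t} → 1 ≤ t → m * (t ∸ 1) + m ≡ m * t
m+m*[t-1] m {suc t} _ = trans (+-comm (m * t) m) (sym (*-suc m t))

-- If b members each miss at least m - k + 1 of m points and each point is missed at most
-- t - 1 times, then m > t k leaves room only for b ≤ t - 1.
few-missers : ∀ {b m k t} → 1 ≤ t → 1 ≤ k → t * k < m → b * (m ∸ (k ∸ 1)) ≤ m * (t ∸ 1) → b ≤ t ∸ 1
few-missers {b} {m} {suc k} {suc t} _ _ large le = ≮⇒≥ λ t<b → <-irrefl refl (<-≤-trans large (begin
  m                       ≡⟨ m∸n+n≡m k≤m ⟨
  d + k                   ≤⟨ +-monoˡ-≤ k (d≤ t<b) ⟩
  k * t + k               ≡⟨ cong (_+ k) (*-comm k t) ⟩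
  t * k + k               ≡⟨ +-comm (t * k) k ⟩
  suc t * k               ≤⟨ *-monoʳ-≤ (suc t) (n≤1+n k) ⟩
  suc t * suc k           ∎))
  where
  open ≤-Reasoning
  d = m ∸ k
  k≤m : k ≤ m
  k≤m = ≤-trans (n≤1+n k) (≤-trans (m≤m+n (suc k) (t * suc k)) (<⇒≤ large))
  d≤ : t < b → d ≤ k * t
  d≤ t<b = +-cancelʳ-≤ (t * d) d (k * t) (begin
    d + t * d      ≤⟨ *-monoˡ-≤ d t<b ⟩
    b * d          ≤⟨ le ⟩
    m * t          ≡⟨ cong (_* t) (m∸n+n≡m k≤m) ⟨
    (d + k) * t    ≡⟨ *-distribʳ-+ t d k ⟩
    d * t + k * t  ≡⟨ +-comm (d * t) (k * t) ⟩
    k * t + d * t  ≡⟨ cong (k * t +_) (*-comm d t) ⟩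
    k * t + t * d  ∎)

+-tight : ∀ {a a′ b b′} → a ≤ a′ → b ≤ b′ → a′ + b′ ≤ a + b → a′ ≤ a × b′ ≤ b
+-tight {a} {a′} {b} {b′} a≤ b≤ le =
  +-cancelʳ-≤ b a′ a (≤-trans (+-monoʳ-≤ a′ b≤) le) , +-cancelˡ-≤ a b′ b (≤-trans (+-monoˡ-≤ b′ a≤) le)

module Counting {n k t : ℕ} {F : List (Subset n)} (fam : KFamily n k F) (ui : UnionIntersecting t F)
  (1≤k : 1 ≤ k) (1≤t : 1 ≤ t) {c : Fin n} {E : Subset n}
  (∣E∣ : ∣ E ∣ ≡ k ∸ 1) (c∉E : c ∉ E) (cover : ∀ {A} → A ∈ᴸ F → c ∈ A ⊎ E ⊆ A) where

  open Families fam ui 1≤k 1≤t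
  open Kernel {n} {k} {c} {E} 1≤k ∣E∣ c∉E
  open import Data.List.Membership.DecPropositional (Vec.≡-dec {n = n} Bool._≟_) using () renaming (_∈?_ to _∈ᴸ?_)

  private
    uF = proj₁ fam
    kF = proj₂ fam
    hits? = λ A → nonempty? (A ∩ E)
    S = filter (c ∈?_) F

  hitting rest strays : List (Subset n)
  hitting = filter hits? S
  rest = filter (¬? ∘ hits?) S
  strays = filter (λ A → ¬? (c ∈? A)) F

  length-parts : (length hitting + length rest) + length strays ≡ length F
  length-parts = trans (cong (_+ length strays) (length-filter-split hits? S)) (length-filter-split (c ∈?_) F)

  ∈-hitting⁻ : ∀ {A} → A ∈ᴸ hitting → A ∈ᴸ F × c ∈ A × Nonempty (A ∩ E)
  ∈-hitting⁻ A∈ with ∈-filter⁻ hits? {xs = S} A∈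
  ... | A∈S , hit with ∈-filter⁻ (c ∈?_) {xs = F} A∈S
  ...   | A∈F , c∈A = A∈F , c∈A , hit

  ∈-rest⁺ : ∀ {A} → A ∈ᴸ F → c ∈ A → Empty (A ∩ E) → A ∈ᴸ rest
  ∈-rest⁺ A∈F c∈A miss = ∈-filter⁺ (¬? ∘ hits?) (∈-filter⁺ (c ∈?_) A∈F c∈A) miss

  ∈-rest⁻ : ∀ {A} → A ∈ᴸ rest → A ∈ᴸ F × c ∈ A × Empty (A ∩ E)
  ∈-rest⁻ A∈ with ∈-filter⁻ (¬? ∘ hits?) {xs = S} A∈
  ... | A∈S , miss with ∈-filter⁻ (c ∈?_) {xs = F} A∈S
  ...   | A∈F , c∈A = A∈F , c∈A , miss

  rest-unique : Unique rest
  rest-unique = Unique.filter⁺ (¬? ∘ hits?) (Unique.filter⁺ (c ∈?_) uF)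

  petal? : ∀ x → Dec (x ≢ c × x ∉ E × E ∪ ⁅ x ⁆ ∈ᴸ F)
  petal? x = ¬? (x Fin.≟ c) ×-dec ¬? (x ∈? E) ×-dec ((E ∪ ⁅ x ⁆) ∈ᴸ? F)

  X : Subset n
  X = ⟪ petal? ⟫

  xs : List (Fin n)
  xs = elements X

  m : ℕ
  m = ∣ X ∣

  ∈-xs⁻ : ∀ {x} → x ∈ᴸ xs → x ≢ c × x ∉ E × E ∪ ⁅ x ⁆ ∈ᴸ F
  ∈-xs⁻ x∈ = ∈⟪⟫⁻ petal? (∈-elements⁻ x∈)

  c∉X : c ∉ X
  c∉X c∈ = proj₁ (∈⟪⟫⁻ petal? c∈) refl

  X∩E=∅ : Empty (X ∩ E)
  X∩E=∅ (x , x∈) with x∈p∩q⁻ X E x∈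
  ... | x∈X , x∈E = proj₁ (proj₂ (∈⟪⟫⁻ petal? x∈X)) x∈E

  petals-fit : m + k ≤ n
  petals-fit = begin
    m + k                     ≡⟨ cong (m +_) 1+[k-1] ⟨
    m + suc (k ∸ 1)           ≡⟨ +-suc m (k ∸ 1) ⟩
    suc m + (k ∸ 1)           ≡⟨ cong₂ _+_ (∣⁅c⁆∪Y∣ c∉X) ∣E∣ ⟨
    ∣ ⁅ c ⁆ ∪ X ∣ + ∣ E ∣     ≡⟨ ∣∣-disjoint-∪ dis ⟨
    ∣ (⁅ c ⁆ ∪ X) ∪ E ∣       ≤⟨ ∣p∣≤n ((⁅ c ⁆ ∪ X) ∪ E) ⟩
    n                         ∎
    where
    open ≤-Reasoning
    dis : Empty ((⁅ c ⁆ ∪ X) ∩ E)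
    dis = ⊆∁⇒∩-∅ (∪-⊆ (⁅⁆⊆ (x∉p⇒x∈∁p c∉E)) (∩-∅⇒⊆∁ X∩E=∅))

  stray-is-petal : ∀ {A} → A ∈ᴸ F → c ∉ A → ∃ λ x → x ∈ᴸ xs × A ≡ E ∪ ⁅ x ⁆
  stray-is-petal {A} A∈F c∉A with cover A∈F
  ... | inj₁ c∈A = contradiction c∈A c∉A
  ... | inj₂ E⊆A with Fin.any? (λ x → x ∈? A ×-dec ¬? (x ∈? E))
  ...   | no ¬x = contradiction (≤-trans (≤-reflexive (trans 1+[k-1] (sym (All.lookup kF A∈F))))
            (≤-trans (p⊆q⇒∣p∣≤∣q∣ A⊆E) (≤-reflexive ∣E∣))) (<-irrefl refl)
    where
    A⊆E : A ⊆ E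
    A⊆E {x} x∈A with x ∈? E
    ... | yes x∈E = x∈E
    ... | no x∉E = contradiction (x , x∈A , x∉E) ¬x
  ...   | yes (x , x∈A , x∉E) = x , ∈-elements⁺ (∈⟪⟫⁺ petal? ((λ { refl → c∉A x∈A }) , x∉E , subst (_∈ᴸ F) (sym A≡) A∈F)) , sym A≡
    where
    A≡ : E ∪ ⁅ x ⁆ ≡ A
    A≡ = ⊆-∣∣≡⇒≡ (∪-⊆ E⊆A (⁅⁆⊆ x∈A))
      (≤-reflexive (trans (All.lookup kF A∈F) (sym (trans (∣E∪⁅x⁆∣ x∉E) (trans (cong suc ∣E∣) 1+[k-1])))))

  length-strays : length strays ≤ m
  length-strays = ≤-trans (length-⊆ {ys = map (λ x → E ∪ ⁅ x ⁆) xs} (Unique.filter⁺ (λ A → ¬? (c ∈? A)) uF) strays⊆)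
    (≤-reflexive (trans (length-map (λ x → E ∪ ⁅ x ⁆) xs) (length-elements X)))
    where
    strays⊆ : strays ⊆ᴸ map (λ x → E ∪ ⁅ x ⁆) xs
    strays⊆ A∈ with ∈-filter⁻ (λ A → ¬? (c ∈? A)) {xs = F} A∈
    ... | A∈F , c∉A with stray-is-petal A∈F c∉A
    ...   | x , x∈ , refl = ∈-map⁺ (λ x → E ∪ ⁅ x ⁆) x∈

  hitting⊆ : hitting ⊆ᴸ hitters
  hitting⊆ A∈ with ∈-hitting⁻ A∈
  ... | A∈F , c∈A , hit = ∈-hitters⁺ (All.lookup kF A∈F) c∈A hit

  length-hitting : length hitting ≤ length hitters
  length-hitting = length-⊆ (Unique.filter⁺ hits? (Unique.filter⁺ (c ∈?_) uF)) hitting⊆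

  missing : Fin n → List (Subset n)
  missing x = filter (λ A → ¬? (x ∈? A)) rest

  -- A member of `rest` misses `E`; if it misses `x` too, it is disjoint from the member `E ∪ ⁅ x ⁆`
  -- of `F`.
  length-missing : ∀ {x} → x ∈ᴸ xs → length (missing x) ≤ t ∸ 1
  length-missing {x} x∈ = ≤-trans
    (length-⊆ (Unique.filter⁺ (λ A → ¬? (x ∈? A)) rest-unique) missing⊆)
    (few-disjoint (proj₂ (proj₂ (∈-xs⁻ x∈))))
    where
    missing⊆ : missing x ⊆ᴸ filter (disjoint? (E ∪ ⁅ x ⁆)) F
    missing⊆ {A} A∈ with ∈-filter⁻ (λ A → ¬? (x ∈? A)) {xs = rest} A∈
    ... | A∈rest , x∉A with ∈-rest⁻ A∈rest
    ...   | A∈F , c∈A , miss = ∈-filter⁺ (disjoint? (E ∪ ⁅ x ⁆)) A∈F dis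
      where
      dis : Empty ((E ∪ ⁅ x ⁆) ∩ A)
      dis (y , y∈) with x∈p∩q⁻ (E ∪ ⁅ x ⁆) A y∈
      ... | y∈Ex , y∈A with x∈p∪q⁻ E ⁅ x ⁆ y∈Ex
      ...   | inj₁ y∈E = miss (y , x∈p∩q⁺ (y∈A , y∈E))
      ...   | inj₂ y∈x = x∉A (subst (_∈ A) (x∈⁅y⁆⇒x≡y x y∈x) y∈A)

  μ : Subset n → ℕ
  μ A = length (filter (λ x → ¬? (x ∈? A)) xs)

  ∑-missing : ∑ xs (length ∘ missing) ≤ m * (t ∸ 1)
  ∑-missing = ≤-trans (∑-bound xs length-missing) (≤-reflexive (cong (_* (t ∸ 1)) (length-elements X)))

  ∑-μ : ∑ rest μ ≡ ∑ xs (length ∘ missing)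
  ∑-μ = double-counting (λ A x → ¬? (x ∈? A)) rest xs

  full : List (Subset n)
  full = filter (λ A → μ A ≟ 0) rest

  ∑-μ⊔1 : ∑ rest (λ A → μ A ⊔ 1) ≡ length full + ∑ rest μ
  ∑-μ⊔1 = ∑-⊔1 μ rest

  -- A member that misses no petal is paid for by `full`, any other by a petal that it misses.
  -- Nothing is lost exactly when no member misses two petals.
  length-rest : length rest ≤ ∑ rest (λ A → μ A ⊔ 1)
  length-rest = ≤-trans (≤-reflexive (trans (sym (*-identityʳ (length rest))) (sym (∑-const rest 1))))
    (∑-mono rest (λ {A} _ → m≤n⊔m (μ A) 1))

  μ≡0⇒X⊆ : ∀ {A} → μ A ≡ 0 → X ⊆ A
  μ≡0⇒X⊆ {A} μ≡0 {x} x∈X with x ∈? A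
  ... | yes x∈A = x∈A
  ... | no x∉A = contradiction (∈-length (∈-filter⁺ (λ x → ¬? (x ∈? A)) (∈-elements⁺ x∈X) x∉A))
    (λ 0<μ → <-irrefl refl (≤-trans 0<μ (≤-reflexive μ≡0)))

  full⊆avoiders : ∀ {Y} → Y ⊆ X → ∣ Y ∣ < k → full ⊆ᴸ avoiders Y
  full⊆avoiders Y⊆X Y<k A∈ with ∈-filter⁻ (λ A → μ A ≟ 0) {xs = rest} A∈
  ... | A∈rest , μ≡0 with ∈-rest⁻ A∈rest
  ...   | A∈F , c∈A , miss =
    ∈-avoiders⁺ (c∉X ∘ Y⊆X) Y<k (All.lookup kF A∈F) c∈A (λ y∈Y → μ≡0⇒X⊆ μ≡0 (Y⊆X y∈Y)) miss

  -- A full member contains all of `X`, hence every `Y` inside it. A smaller `Y` is what keeps the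
  -- bound available when `X` has k or more points: γ + 1 petals are used for m > γ, and `X` itself
  -- in the case of equality.
  length-full : ∀ {Y} → Y ⊆ X → ∣ Y ∣ < k → length full ≤ (n ∸ k ∸ ∣ Y ∣) C (k ∸ ∣ Y ∣ ∸ 1)
  length-full {Y} Y⊆X Y<k = ≤-trans
    (length-⊆ (Unique.filter⁺ (λ A → μ A ≟ 0) rest-unique) (full⊆avoiders {Y} Y⊆X Y<k))
    (≤-reflexive (length-avoiders {Y} (c∉X ∘ Y⊆X) (λ (x , x∈) → let x∈Y , x∈E = x∈p∩q⁻ Y E x∈ in X∩E=∅ (x , x∈p∩q⁺ (Y⊆X x∈Y , x∈E)))))

  length-F≤ : ∀ {r} → length rest ≤ r → length F ≤ length hitters + (r + m)
  length-F≤ {r} rest≤r = begin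
    length F                                            ≡⟨ length-parts ⟨
    (length hitting + length rest) + length strays      ≡⟨ +-assoc (length hitting) _ _ ⟩
    length hitting + (length rest + length strays)      ≤⟨ +-mono-≤ length-hitting (+-mono-≤ rest≤r length-strays) ⟩
    length hitters + (r + m)                            ∎
    where open ≤-Reasoning

  rest≤full : length rest ≤ length full + m * (t ∸ 1)
  rest≤full = ≤-trans length-rest (≤-trans (≤-reflexive ∑-μ⊔1)
    (+-monoʳ-≤ (length full) (≤-trans (≤-reflexive ∑-μ) ∑-missing)))

  length-F≤-kernel : ∀ {Y} → Y ⊆ X → ∣ Y ∣ < k →
    length F ≤ length hitters + ((n ∸ k ∸ ∣ Y ∣) C (k ∸ ∣ Y ∣ ∸ 1) + m * t)
  length-F≤-kernel {Y} Y⊆X Y<k = ≤-trans (length-F≤ (≤-trans rest≤full (+-monoˡ-≤ (m * (t ∸ 1)) (length-full {Y} Y⊆X Y<k))))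
    (+-monoʳ-≤ (length hitters) (≤-reflexive (trans (+-assoc v (m * (t ∸ 1)) m) (cong (v +_) (m+m*[t-1] m 1≤t)))))
    where v = (n ∸ k ∸ ∣ Y ∣) C (k ∸ ∣ Y ∣ ∸ 1)

  -- One of the k points of `A` is `c`, which is not a petal.
  k-1-petals-inside : ∀ {A} → A ∈ᴸ rest → m ∸ (k ∸ 1) ≤ μ A
  k-1-petals-inside {A} A∈rest with ∈-rest⁻ A∈rest
  ... | A∈F , c∈A , _ = m≤n+o⇒m∸n≤o m (k ∸ 1) (begin
    m                                            ≡⟨ length-elements X ⟨
    length xs                                    ≡⟨ length-filter-split (_∈? A) xs ⟨
    length (filter (_∈? A) xs) + μ A             ≤⟨ +-monoˡ-≤ (μ A) (s≤s⁻¹ inside≤) ⟩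
    (k ∸ 1) + μ A                                ∎)
    where
    open ≤-Reasoning
    inside≤ : suc (length (filter (_∈? A) xs)) ≤ suc (k ∸ 1)
    inside≤ = ≤-trans (length≤∣∣ {p = A} {xs = c ∷ filter (_∈? A) xs}
        (All.¬Any⇒All¬ _ (λ c∈ → proj₁ (∈-xs⁻ (proj₁ (∈-filter⁻ (_∈? A) {xs = xs} c∈))) refl)
          ∷ Unique.filter⁺ (_∈? A) (elements-unique X))
        (λ { (here refl) → c∈A ; (there x∈) → proj₂ (∈-filter⁻ (_∈? A) {xs = xs} x∈) }))
      (≤-reflexive (trans (All.lookup kF A∈F) (sym 1+[k-1])))

  -- Each member of `rest` misses almost all of the m petals, while each petal is missed at most t-1
  -- times; `few-missers` turns this into a bound on `rest` independent of n.
  length-F≤-many : t * k < m → length F ≤ length hitters + ((t ∸ 1) + m)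
  length-F≤-many tk<m = length-F≤ (few-missers {k = k} {t} 1≤t 1≤k tk<m (begin
    length rest * (m ∸ (k ∸ 1))                ≡⟨ ∑-const rest (m ∸ (k ∸ 1)) ⟨
    ∑ rest (λ _ → m ∸ (k ∸ 1))                 ≤⟨ ∑-mono rest k-1-petals-inside ⟩
    ∑ rest μ                                   ≡⟨ ∑-μ ⟩
    ∑ xs (length ∘ missing)                    ≤⟨ ∑-missing ⟩
    m * (t ∸ 1)                                ∎))
    where open ≤-Reasoning

-- The case of equality: reading the construction off the family

lookup-injective : {A : Set} {xs : List A} → Unique xs → ∀ i j → lookup xs i ≡ lookup xs j → i ≡ j
lookup-injective (x∉ ∷ u) zero zero _ = refl
lookup-injective (x∉ ∷ u) zero (suc j) eq = contradiction eq (All.lookup x∉ (∈-lookup j))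
lookup-injective (x∉ ∷ u) (suc i) zero eq = contradiction (sym eq) (All.lookup x∉ (∈-lookup i))
lookup-injective (x∉ ∷ u) (suc i) (suc j) eq = cong suc (lookup-injective u i j eq)

image-id : ∀ {n} (A : Subset n) → image Perm.id A ≡ A
image-id = Vec.tabulate∘lookup

module Extremal {n k t : ℕ} {F : List (Subset n)} (fam : KFamily n k F) (ui : UnionIntersecting t F)
  (1≤k : 1 ≤ k) (1≤t : 1 ≤ t) {c : Fin n} {E : Subset n}
  (∣E∣ : ∣ E ∣ ≡ k ∸ 1) (c∉E : c ∉ E) (cover : ∀ {A} → A ∈ᴸ F → c ∈ A ⊎ E ⊆ A) where

  open Counting fam ui 1≤k 1≤t ∣E∣ c∉E cover public
  open Kernel {n} {k} {c} {E} 1≤k ∣E∣ c∉E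

  private
    uF = proj₁ fam
    kF = proj₂ fam

  module _ (m<k : m < k)
    (extremal : length hitters + ((n ∸ k ∸ m) C (k ∸ m ∸ 1) + m * t) ≤ length F) where

    private
      v = (n ∸ k ∸ m) C (k ∸ m ∸ 1)
      open ≤-Reasoning

      rest≤ : length rest ≤ v + m * (t ∸ 1)
      rest≤ = ≤-trans rest≤full (+-monoˡ-≤ (m * (t ∸ 1)) (length-full {X} id m<k))

      -- By `extremal` the size of `F` reaches the sum of the separate upper bounds, so each of them
      -- is attained. This splits off the hitting members, `rest≥` the strays, and `inner` divides
      -- `rest` into full members and missed petals.
      outer : length hitters ≤ length hitting × (v + m * (t ∸ 1)) + m ≤ length rest + length strays
      outer = +-tight length-hitting (+-mono-≤ rest≤ length-strays) (begin
        length hitters + ((v + m * (t ∸ 1)) + m)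
          ≡⟨ cong (length hitters +_) (trans (+-assoc v (m * (t ∸ 1)) m) (cong (v +_) (m+m*[t-1] m 1≤t))) ⟩
        length hitters + (v + m * t)
          ≤⟨ extremal ⟩
        length F
          ≡⟨ length-parts ⟨
        (length hitting + length rest) + length strays
          ≡⟨ +-assoc (length hitting) (length rest) (length strays) ⟩
        length hitting + (length rest + length strays) ∎)

      rest≥ : v + m * (t ∸ 1) ≤ length rest
      rest≥ = proj₁ (+-tight rest≤ length-strays (proj₂ outer))

      inner : v ≤ length full × m * (t ∸ 1) ≤ ∑ xs (length ∘ missing)
      inner = +-tight (length-full {X} id m<k) ∑-missing (≤-trans rest≥ (≤-trans length-rest
        (≤-reflexive (trans ∑-μ⊔1 (cong (length full +_) ∑-μ)))))

      -- The length of `rest` is a sum of ones, and it now equals the sum of `μ A ⊔ 1`, so the terms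
      -- agree one by one.
      μ≤1 : ∀ {A} → A ∈ᴸ rest → μ A ≤ 1
      μ≤1 {A} A∈ = ≤-trans (m≤m⊔n (μ A) 1) (∑-tight rest (λ {A} _ → m≤n⊔m (μ A) 1) (begin
        ∑ rest (λ A → μ A ⊔ 1)                  ≡⟨ ∑-μ⊔1 ⟩
        length full + ∑ rest μ                  ≤⟨ +-mono-≤ (length-full {X} id m<k) (≤-trans (≤-reflexive ∑-μ) ∑-missing) ⟩
        v + m * (t ∸ 1)                         ≤⟨ rest≥ ⟩
        length rest                             ≡⟨ trans (sym (*-identityʳ (length rest))) (sym (∑-const rest 1)) ⟩
        ∑ rest (λ _ → 1)                        ∎) A∈)

      missing≥ : ∀ {x} → x ∈ᴸ xs → t ∸ 1 ≤ length (missing x)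
      missing≥ = ∑-tight xs length-missing (≤-trans (≤-reflexive (trans (∑-const xs (t ∸ 1))
        (cong (_* (t ∸ 1)) (length-elements X)))) (proj₂ inner))

      hitters⊆hitting : hitters ⊆ᴸ hitting
      hitters⊆hitting = ⊆-length⇒⊇ (Vec.≡-dec Bool._≟_)
        (Unique.filter⁺ (λ A → nonempty? (A ∩ E)) (Unique.filter⁺ (c ∈?_) uF)) hitting⊆ (proj₁ outer)

      avoiders⊆full : avoiders X ⊆ᴸ full
      avoiders⊆full = ⊆-length⇒⊇ (Vec.≡-dec Bool._≟_) (Unique.filter⁺ (λ A → μ A ≟ 0) rest-unique)
        (full⊆avoiders {X} id m<k) (≤-trans (≤-reflexive (length-avoiders {X} c∉X X∩E=∅)) (proj₁ inner))

      x : Fin (length xs) → Fin n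
      x = lookup xs

      x∈ : ∀ j → x j ∈ᴸ xs
      x∈ = ∈-lookup

      same-miss : ∀ {A} → A ∈ᴸ rest → ∀ {y z} → y ∈ᴸ xs → z ∈ᴸ xs → y ∉ A → z ∉ A → y ≡ z
      same-miss {A} A∈ {y} {z} y∈ z∈ y∉A z∉A with y Fin.≟ z
      ... | yes eq = eq
      ... | no y≢z = contradiction (≤-trans (length-⊆ {xs = y ∷ z ∷ []} ((y≢z ∷ []) ∷ [] ∷ [])
        λ { (here refl) → ∈-filter⁺ (λ x → ¬? (x ∈? A)) y∈ y∉A
          ; (there (here refl)) → ∈-filter⁺ (λ x → ¬? (x ∈? A)) z∈ z∉A }) (μ≤1 A∈)) λ { (s≤s ()) }

    -- Each `missing (x j)` has exactly t-1 members by tightness. By `μ≤1` none of them misses a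
    -- second petal, which is the condition on J and B in the construction.
    params : JParams n (length xs)
    params = record { c = c ; x = x ; E = E ; B = λ j → missing (x j) }

    params-valid : ValidJParams params k t
    params-valid =
      (λ j → proj₁ (∈-xs⁻ (x∈ j))) ,
      lookup-injective (elements-unique X) ,
      ∣E∣ ,
      J∉E ,
      (λ j → Unique.filter⁺ (λ A → ¬? (x j ∈? A)) rest-unique ,
             ≤-antisym (length-missing (x∈ j)) (missing≥ (x∈ j)) ,
             All.tabulate (valid-B j))
      where
      J∉E : ∀ y → InJset params y → y ∉ E
      J∉E y (inj₁ refl) = c∉E
      J∉E y (inj₂ (j , refl)) = proj₁ (proj₂ (∈-xs⁻ (x∈ j)))
      valid-B : ∀ j {A} → A ∈ᴸ missing (x j) →
        ∣ A ∣ ≡ k × Empty (A ∩ E) × (∀ y → InJset params y → (y ∉ A → y ≡ x j) × (y ≡ x j → y ∉ A))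
      valid-B j {A} A∈ with ∈-filter⁻ (λ A → ¬? (x j ∈? A)) {xs = rest} A∈
      ... | A∈rest , xⱼ∉A with ∈-rest⁻ A∈rest
      ...   | A∈F , c∈A , miss = All.lookup kF A∈F , miss , λ y y∈J → only y y∈J , λ { refl → xⱼ∉A }
        where
        only : ∀ y → InJset params y → y ∉ A → y ≡ x j
        only y (inj₁ refl) y∉A = contradiction c∈A y∉A
        only y (inj₂ (l , refl)) y∉A = same-miss A∈rest (x∈ l) (x∈ j) y∉A xⱼ∉A

    F⊆J : ∀ {A} → A ∈ᴸ F → InJFamily params k A
    F⊆J {A} A∈F with c ∈? A
    ... | no c∉A with stray-is-petal A∈F c∉A
    ...   | y , y∈ , A≡ = inj₂ (inj₁ (Any.index y∈ , trans A≡ (cong (λ z → E ∪ ⁅ z ⁆) (Any.lookup-index y∈))))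
    F⊆J {A} A∈F | yes c∈A with nonempty? (A ∩ E)
    ... | yes (y , y∈) = inj₁ (All.lookup kF A∈F , c∈A , λ j →
          let y∈A , y∈E = x∈p∩q⁻ A E y∈ in y , x∈p∩q⁺ (y∈A , p⊆p∪q ⁅ x j ⁆ y∈E))
    ... | no miss with Fin.any? (λ j → ¬? (x j ∈? A))
    ...   | yes (j , xⱼ∉A) = inj₂ (inj₂ (j , ∈-filter⁺ (λ A → ¬? (x j ∈? A)) (∈-rest⁺ A∈F c∈A miss) xⱼ∉A))
    ...   | no ¬j = inj₁ (All.lookup kF A∈F , c∈A , λ j →
            x j , x∈p∩q⁺ (decidable-stable (x j ∈? A) (λ xⱼ∉A → ¬j (j , xⱼ∉A)) , q⊆p∪q E ⁅ x j ⁆ (x∈⁅x⁆ (x j))))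

    J⊆F : ∀ {A} → InJFamily params k A → A ∈ᴸ F
    J⊆F {A} (inj₁ (∣A∣ , c∈A , meets)) with nonempty? (A ∩ E)
    ... | yes hit = proj₁ (∈-hitting⁻ (hitters⊆hitting (∈-hitters⁺ ∣A∣ c∈A hit)))
    ... | no miss = proj₁ (∈-rest⁻ (proj₁ (∈-filter⁻ (λ A → μ A ≟ 0) {xs = rest}
          (avoiders⊆full (∈-avoiders⁺ c∉X m<k ∣A∣ c∈A X⊆A miss)))))
      where
      X⊆A : X ⊆ A
      X⊆A {y} y∈X with Any.index (∈-elements⁺ y∈X) | Any.lookup-index (∈-elements⁺ y∈X)
      ... | j | refl with meets j
      ...   | z , z∈ with x∈p∩q⁻ A (E ∪ ⁅ x j ⁆) z∈
      ...     | z∈A , z∈Aⱼ with x∈p∪q⁻ E ⁅ x j ⁆ z∈Aⱼ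
      ...       | inj₁ z∈E = contradiction (z , x∈p∩q⁺ (z∈A , z∈E)) miss
      ...       | inj₂ z∈x = subst (_∈ A) (x∈⁅y⁆⇒x≡y (x j) z∈x) z∈A
    J⊆F (inj₂ (inj₁ (j , refl))) = proj₂ (proj₂ (∈-xs⁻ (x∈ j)))
    J⊆F (inj₂ (inj₂ (j , A∈))) = proj₁ (∈-rest⁻ (proj₁ (∈-filter⁻ (λ A → ¬? (x j ∈? A)) {xs = rest} A∈)))

    -- The centre, petals and kernel are taken from `F` itself, so the identity serves as the
    -- isomorphism.
    extremal⇒J : IsoToJ n k t m F
    extremal⇒J = subst (λ i → IsoToJ n k t i F) (length-elements X)
      (params , params-valid , Perm.id , λ A →
        (λ A∈F → subst (InJFamily params k) (sym (image-id A)) (F⊆J A∈F)) ,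
        (λ A∈J → J⊆F (subst (InJFamily params k) (image-id A) A∈J)))

-- Bounds from above and below

module Upper {n k t β : ℕ} {F : List (Subset n)} (fam : KFamily n k F) (ui : UnionIntersecting t F)
  (5≤k : 5 ≤ k) (2≤t : 2 ≤ t) (γ≤k-2 : suc β ≤ k ∸ 2) (large : 2 + k + t * k * t ≤ n ∸ k ∸ suc β)
  {c : Fin n} {E : Subset n}
  (∣E∣ : ∣ E ∣ ≡ k ∸ 1) (c∉E : c ∉ E) (cover : ∀ {A} → A ∈ᴸ F → c ∈ A ⊎ E ⊆ A) where

  private
    γ = suc β
    1≤k : 1 ≤ k
    1≤k = ≤-trans (s≤s z≤n) 5≤k
    1≤t : 1 ≤ t
    1≤t = ≤-trans (s≤s z≤n) 2≤t

  open Extremal fam ui 1≤k 1≤t ∣E∣ c∉E cover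
  open Kernel {n} {k} {c} {E} 1≤k ∣E∣ c∉E

  private
    open ≤-Reasoning
    M = n ∸ k ∸ γ
    J = k ∸ γ ∸ 1

    2+γ≤k : 2 + γ ≤ k
    2+γ≤k = ≤-trans (+-monoʳ-≤ 2 γ≤k-2) (≤-reflexive (m+[n∸m]≡n (≤-trans (s≤s (s≤s z≤n)) 5≤k)))

    γ<k : γ < k
    γ<k = ≤-trans (n≤1+n _) 2+γ≤k

    J≡ : J ≡ k ∸ suc γ
    J≡ = trans (∸-+-assoc k γ 1) (cong (k ∸_) (+-comm γ 1))

    1≤J : 1 ≤ J
    1≤J = ≤-trans (m<n⇒0<n∸m 2+γ≤k) (≤-reflexive (sym J≡))

    J≤k : J ≤ k
    J≤k = ≤-trans (m∸n≤m (k ∸ γ) 1) (m∸n≤m k γ)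

    γ<n-k : γ < n ∸ k
    γ<n-k = ≰⇒> λ n-k≤γ → contradiction (≤-trans large (≤-reflexive (m≤n⇒m∸n≡0 n-k≤γ))) λ ()

    M≡ : M ≡ suc (n ∸ k ∸ suc γ)
    M≡ = +-∸-assoc 1 γ<n-k

    1+k+tkt≤ : 1 + k + t * k * t ≤ n ∸ k ∸ suc γ
    1+k+tkt≤ = s≤s⁻¹ (≤-trans large (≤-reflexive M≡))

    bound≡ : length hitters + (M C J + γ * t) ≡ bound n k t γ
    bound≡ = trans (sym (+-assoc (length hitters) (M C J) (γ * t))) (cong (λ h → h + M C J + γ * t) length-hitters)

    -- Up to m = t k the cost `m * t` is at most t k t, which the assumption on n dominates, and γ +
    -- 1 petals already make full members too rare. Beyond t k hardly any of `rest` survives, and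
    -- the strays number at most n - k by `petals-fit`.
    excess : γ < m → length F < bound n k t γ
    excess γ<m with m ≤? t * k
    ... | yes m≤tk with subset-of-size X γ<m
    ...   | Y , Y⊆X , ∣Y∣ = begin-strict
      length F
        ≤⟨ length-F≤-kernel {Y} Y⊆X (≤-trans (≤-reflexive (cong suc ∣Y∣)) 2+γ≤k) ⟩
      length hitters + ((n ∸ k ∸ ∣ Y ∣) C (k ∸ ∣ Y ∣ ∸ 1) + m * t)
        ≡⟨ cong (λ y → length hitters + ((n ∸ k ∸ y) C (k ∸ y ∸ 1) + m * t)) ∣Y∣ ⟩
      length hitters + (M′ C (k ∸ suc γ ∸ 1) + m * t)
        ≡⟨ cong (λ j → length hitters + (M′ C (j ∸ 1) + m * t)) J≡ ⟨
      length hitters + (M′ C (J ∸ 1) + m * t)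
        <⟨ +-monoʳ-< (length hitters) (drop-one m γ t 1≤J
             (≤-trans (s≤s (≤-trans J≤k (m≤m+n k (t * k * t)))) 1+k+tkt≤)
             (≤-trans (s≤s (≤-trans (*-monoˡ-≤ t m≤tk) (m≤n+m (t * k * t) k))) 1+k+tkt≤)) ⟩
      length hitters + (suc M′ C J + γ * t)
        ≡⟨ cong (λ a → length hitters + (a C J + γ * t)) M≡ ⟨
      length hitters + (M C J + γ * t)
        ≡⟨ bound≡ ⟩
      bound n k t γ ∎
      where M′ = n ∸ k ∸ suc γ
    excess γ<m | no m≰tk = begin-strict
      length F
        ≤⟨ length-F≤-many (≰⇒> m≰tk) ⟩
      length hitters + ((t ∸ 1) + m)
        ≤⟨ +-monoʳ-≤ (length hitters) (+-monoʳ-≤ (t ∸ 1) (begin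
             m              ≡⟨ m+n∸n≡m m k ⟨
             m + k ∸ k      ≤⟨ ∸-monoˡ-≤ k petals-fit ⟩
             n ∸ k          ≡⟨ m∸n+n≡m (<⇒≤ γ<n-k) ⟨
             M + γ          ∎)) ⟩
      length hitters + ((t ∸ 1) + (M + γ))
        <⟨ +-monoʳ-< (length hitters) (few-stray β t 2≤t 1≤J J≥2
             (≤-trans (s≤s (s≤s (≤-trans J≤k (m≤m+n k (t * k * t))))) large)) ⟩
      length hitters + (M C J + γ * t)
        ≡⟨ bound≡ ⟩
      bound n k t γ ∎
      where
      J≥2 : β ≡ 0 → 2 ≤ J
      J≥2 refl = ≤-trans (s≤s (s≤s z≤n)) (≤-trans (∸-monoˡ-≤ 2 5≤k) (≤-reflexive (sym J≡)))

  upper-bound : γ ≤ m → length F ≤ bound n k t γ × (length F ≡ bound n k t γ → IsoToJ n k t γ F)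
  upper-bound γ≤m with m ≟ γ
  ... | no m≢γ = <⇒≤ F<bound , λ eq → contradiction F<bound (<-irrefl eq)
    where F<bound = excess (≤∧≢⇒< γ≤m (m≢γ ∘ sym))
  ... | yes m≡γ = ≤-trans (length-F≤-kernel {X} id m<k) (≤-reflexive m-bound) ,
    λ eq → subst (λ i → IsoToJ n k t i F) m≡γ (extremal⇒J m<k (≤-reflexive (trans m-bound (sym eq))))
    where
    m<k : m < k
    m<k = ≤-trans (≤-reflexive (cong suc m≡γ)) γ<k
    m-bound : length hitters + ((n ∸ k ∸ m) C (k ∸ m ∸ 1) + m * t) ≡ bound n k t γ
    m-bound = trans (cong (λ i → length hitters + ((n ∸ k ∸ i) C (k ∸ i ∸ 1) + i * t)) m≡γ) bound≡

-- The construction attains the bound, up to relabelling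

module _ {n i k t : ℕ} (P : JParams n i) (valid : ValidJParams P k t) (i<k : i < k) (1≤t : 1 ≤ t)
  {G : List (Subset n)} (J⊆G : ∀ {A} → InJFamily P k A → A ∈ᴸ G) where

  open JParams P

  private
    1≤k : 1 ≤ k
    1≤k = ≤-trans (s≤s z≤n) i<k
    x≢c = proj₁ valid
    x-inj = proj₁ (proj₂ valid)
    ∣E∣ = proj₁ (proj₂ (proj₂ valid))
    J∉E = proj₁ (proj₂ (proj₂ (proj₂ valid)))
    B-valid = proj₂ (proj₂ (proj₂ (proj₂ valid)))
    c∉E : c ∉ E
    c∉E = J∉E c (inj₁ refl)
    x∉E : ∀ j → x j ∉ E
    x∉E j = J∉E (x j) (inj₂ (j , refl))

  open Kernel {n} {k} {c} {E} 1≤k ∣E∣ c∉E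

  private
    B-⊇c : ∀ {j A} → A ∈ᴸ B j → c ∈ A
    B-⊇c {j} {A} A∈ = decidable-stable (c ∈? A) λ c∉A → x≢c j (sym
      (proj₁ (proj₂ (proj₂ (All.lookup (proj₂ (proj₂ (B-valid j))) A∈)) c (inj₁ refl)) c∉A))

    B-∌x : ∀ {j A} → A ∈ᴸ B j → x j ∉ A
    B-∌x {j} A∈ = proj₂ (proj₂ (proj₂ (All.lookup (proj₂ (proj₂ (B-valid j))) A∈)) (x j) (inj₂ (j , refl))) refl

    B-misses : ∀ {j A} → A ∈ᴸ B j → Empty (A ∩ E)
    B-misses {j} A∈ = proj₁ (proj₂ (All.lookup (proj₂ (proj₂ (B-valid j))) A∈))

    B-disjoint : ∀ {j l} → j ≢ l → ∀ {A} → ¬ (A ∈ᴸ B j × A ∈ᴸ B l)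
    B-disjoint {j} {l} j≢l (A∈Bⱼ , A∈Bₗ) = j≢l (x-inj j l
      (proj₁ (proj₂ (proj₂ (All.lookup (proj₂ (proj₂ (B-valid l))) A∈Bₗ)) (x j) (inj₂ (j , refl))) (B-∌x A∈Bⱼ)))

    x? = λ y → Fin.any? (λ j → x j Fin.≟ y)

    X : Subset n
    X = ⟪ x? ⟫

    x∈X : ∀ j → x j ∈ X
    x∈X j = ∈⟪⟫⁺ x? (j , refl)

    ∣X∣ : ∣ X ∣ ≡ i
    ∣X∣ = trans (∣∣-unique (Unique.map⁺ (λ {j} {l} → x-inj j l) (Unique.allFin⁺ i))
        (λ y∈ → let j , eq = ∈⟪⟫⁻ x? y∈ in subst (_∈ᴸ map x (allFin i)) eq (∈-map⁺ x (∈-allFin j)))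
        (λ y∈ → let j , _ , eq = ∈-map⁻ x y∈ in ∈⟪⟫⁺ x? (j , sym eq)))
      (trans (length-map x (allFin i)) (length-tabulate (λ j → j)))

    c∉X : c ∉ X
    c∉X c∈ = let j , eq = ∈⟪⟫⁻ x? c∈ in x≢c j eq

    X∩E=∅ : Empty (X ∩ E)
    X∩E=∅ (y , y∈) = let y∈X , y∈E = x∈p∩q⁻ X E y∈ ; j , eq = ∈⟪⟫⁻ x? y∈X in x∉E j (subst (_∈ E) (sym eq) y∈E)

    ∣X∣<k : ∣ X ∣ < k
    ∣X∣<k = ≤-trans (≤-reflexive (cong suc ∣X∣)) i<k

    As = map (Aj P) (allFin i)
    Bs = concatMap B (allFin i)

    c∉Aj : ∀ j → c ∉ Aj P j
    c∉Aj j c∈ with x∈p∪q⁻ E ⁅ x j ⁆ c∈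
    ... | inj₁ c∈E = c∉E c∈E
    ... | inj₂ c∈x = x≢c j (sym (x∈⁅y⁆⇒x≡y (x j) c∈x))

    Aj-injective : ∀ {j l} → Aj P j ≡ Aj P l → j ≡ l
    Aj-injective {j} {l} eq with x∈p∪q⁻ E ⁅ x l ⁆ (subst (x j ∈_) eq (q⊆p∪q E ⁅ x j ⁆ (x∈⁅x⁆ (x j))))
    ... | inj₁ x∈E = contradiction x∈E (x∉E j)
    ... | inj₂ x∈x = x-inj j l (x∈⁅y⁆⇒x≡y (x l) x∈x)

    ∈-As⁻ : ∀ {A} → A ∈ᴸ As → ∃ λ j → A ≡ Aj P j
    ∈-As⁻ A∈ = let j , _ , eq = ∈-map⁻ (Aj P) A∈ in j , eq

    ∈-Bs⁻ : ∀ {A} → A ∈ᴸ Bs → ∃ λ j → A ∈ᴸ B j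
    ∈-Bs⁻ A∈ = Any.satisfied (∈-concatMap⁻ B {xs = allFin i} A∈)

    Bs-unique : Unique Bs
    Bs-unique = Unique.concat⁺ (All.map⁺ (All.tabulate (λ {j} _ → proj₁ (B-valid j))))
      (AllPairs.map⁺ {f = B} (AllPairs.map (λ j≢l {A} → B-disjoint j≢l {A}) (Unique.allFin⁺ i)))

    outer = As ++ Bs
    family = hitters ++ (avoiders X ++ outer)

    ∈-outer⁻ : ∀ {A} → A ∈ᴸ outer → (∃ λ j → A ≡ Aj P j) ⊎ (∃ λ j → A ∈ᴸ B j)
    ∈-outer⁻ A∈ = Sum.map ∈-As⁻ ∈-Bs⁻ (∈-++⁻ As A∈)

    outer-unique : Unique outer
    outer-unique = Unique.++⁺ (Unique.map⁺ Aj-injective (Unique.allFin⁺ i)) Bs-unique λ (A∈As , A∈Bs) →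
      let j , eq = ∈-As⁻ A∈As ; _ , A∈B = ∈-Bs⁻ A∈Bs in c∉Aj j (subst (c ∈_) eq (B-⊇c A∈B))

    avoider⇒∉outer : ∀ {A} → A ∈ᴸ avoiders X → A ∉ᴸ outer
    avoider⇒∉outer {A} A∈ A∈outer with ∈-avoiders⁻ {X} c∉X X∩E=∅ ∣X∣<k A∈ | ∈-outer⁻ A∈outer
    ... | _ , c∈A , _ , _ | inj₁ (j , eq) = c∉Aj j (subst (c ∈_) eq c∈A)
    ... | _ , _ , X⊆A , _ | inj₂ (j , A∈B) = B-∌x A∈B (X⊆A (x∈X j))

    hitter⇒∉rest : ∀ {A} → A ∈ᴸ hitters → A ∉ᴸ avoiders X ++ outer
    hitter⇒∉rest A∈ A∈rest with ∈-hitters⁻ A∈ | ∈-++⁻ (avoiders X) A∈rest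
    ... | _ , _ , hit | inj₁ A∈av = proj₂ (proj₂ (proj₂ (∈-avoiders⁻ {X} c∉X X∩E=∅ ∣X∣<k A∈av))) hit
    ... | _ , c∈A , hit | inj₂ A∈outer with ∈-outer⁻ A∈outer
    ...   | inj₁ (j , eq) = c∉Aj j (subst (c ∈_) eq c∈A)
    ...   | inj₂ (j , A∈B) = B-misses A∈B hit

    family-unique : Unique family
    family-unique = Unique.++⁺ hitters-unique
      (Unique.++⁺ (between-unique (⁅ c ⁆ ∪ X) (∁ E) (k ∸ suc ∣ X ∣)) outer-unique
        λ (A∈av , A∈outer) → avoider⇒∉outer A∈av A∈outer)
      λ (A∈hit , A∈rest) → hitter⇒∉rest A∈hit A∈rest

    family⊆G : family ⊆ᴸ G
    family⊆G {A} A∈ with ∈-++⁻ hitters A∈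
    ... | inj₁ A∈hit with ∈-hitters⁻ A∈hit
    ...   | ∣A∣ , c∈A , y , y∈ = J⊆G (inj₁ (∣A∣ , c∈A , λ j →
              let y∈A , y∈E = x∈p∩q⁻ A E y∈ in y , x∈p∩q⁺ (y∈A , p⊆p∪q ⁅ x j ⁆ y∈E)))
    family⊆G A∈ | inj₂ A∈rest with ∈-++⁻ (avoiders X) A∈rest
    ... | inj₁ A∈av with ∈-avoiders⁻ {X} c∉X X∩E=∅ ∣X∣<k A∈av
    ...   | ∣A∣ , c∈A , X⊆A , _ = J⊆G (inj₁ (∣A∣ , c∈A , λ j →
              x j , x∈p∩q⁺ (X⊆A (x∈X j) , q⊆p∪q E ⁅ x j ⁆ (x∈⁅x⁆ (x j)))))
    family⊆G A∈ | inj₂ A∈rest | inj₂ A∈outer with ∈-outer⁻ A∈outer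
    ... | inj₁ A≡ = J⊆G (inj₂ (inj₁ A≡))
    ... | inj₂ A∈B = J⊆G (inj₂ (inj₂ A∈B))

    length-outer : length outer ≡ i * t
    length-outer = begin
      length (As ++ Bs)
        ≡⟨ length-++ As ⟩
      length As + length Bs
        ≡⟨ cong₂ _+_ (trans (length-map (Aj P) (allFin i)) ∣allFin∣)
             (trans (length-concatMap B (allFin i)) ∑B) ⟩
      i + i * (t ∸ 1)
        ≡⟨ +-comm i (i * (t ∸ 1)) ⟩
      i * (t ∸ 1) + i
        ≡⟨ m+m*[t-1] i 1≤t ⟩
      i * t ∎
      where
      open ≡-Reasoning
      ∣allFin∣ : length (allFin i) ≡ i
      ∣allFin∣ = length-tabulate (λ j → j)
      ∑B : ∑ (allFin i) (length ∘ B) ≡ i * (t ∸ 1)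
      ∑B = trans (≤-antisym (∑-mono (allFin i) λ {j} _ → ≤-reflexive (proj₁ (proj₂ (B-valid j))))
                            (∑-mono (allFin i) λ {j} _ → ≤-reflexive (sym (proj₁ (proj₂ (B-valid j))))))
        (trans (∑-const (allFin i) (t ∸ 1)) (cong (_* (t ∸ 1)) ∣allFin∣))

  -- The sets through c meeting every A_j are the hitters and the avoiders of `X`. The A_j omit c
  -- while all other members contain it; hitters meet `E` while avoiders and the B_j do not;
  -- avoiders contain every x_j while a member of B_j omits x_j. The pieces are thus disjoint and
  -- their sizes add up to the bound.
  lower-bound : bound n k t i ≤ length G
  lower-bound = ≤-trans (≤-reflexive (sym (begin
    length family
      ≡⟨ length-++ hitters ⟩
    length hitters + length (avoiders X ++ outer)
      ≡⟨ cong (length hitters +_) (length-++ (avoiders X)) ⟩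
    length hitters + (length (avoiders X) + length outer)
      ≡⟨ +-assoc (length hitters) (length (avoiders X)) (length outer) ⟨
    length hitters + length (avoiders X) + length outer
      ≡⟨ cong₂ _+_ (cong₂ _+_ length-hitters (trans (length-avoiders {X} c∉X X∩E=∅)
           (cong (λ s → (n ∸ k ∸ s) C (k ∸ s ∸ 1)) ∣X∣))) length-outer ⟩
    bound n k t i ∎))) (length-⊆ family-unique family⊆G)
    where open ≡-Reasoning

image-flip : ∀ {n} (σ : Perm.Permutation′ n) (A : Subset n) → image σ (image (Perm.flip σ) A) ≡ A
image-flip σ A = trans (Vec.tabulate-cong λ y → trans
    (Vec.lookup∘tabulate (λ z → Vec.lookup A (σ Perm.⟨$⟩ʳ z)) (σ Perm.⟨$⟩ˡ y))
    (cong (Vec.lookup A) (Perm.inverseʳ σ)))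
  (Vec.tabulate∘lookup A)

-- The list of images of `F` contains the whole construction and is as long as `F`, so `lower-bound`
-- applies to it.
IsoToJ⇒≥ : ∀ {n k t i F} → i < k → 1 ≤ t → IsoToJ n k t i F → bound n k t i ≤ length F
IsoToJ⇒≥ {n} {k} {t} {i} {F} i<k 1≤t (P , valid , σ , iso) =
  ≤-trans (lower-bound P valid i<k 1≤t J⊆) (≤-reflexive (length-map (image σ) F))
  where
  J⊆ : ∀ {A} → InJFamily P k A → A ∈ᴸ map (image σ) F
  J⊆ {A} A∈J = subst (_∈ᴸ map (image σ) F) (image-flip σ A) (∈-map⁺ (image σ)
    (proj₂ (iso (image (Perm.flip σ) A)) (subst (InJFamily P k) (sym (image-flip σ A)) A∈J)))

-- Consequences of the distance from intersecting families

module _ {n k : ℕ} {F : List (Subset n)} (fam : KFamily n k F) {β : ℕ} (ℓ≥γ : ℓ≥ (suc β) F) where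

  ¬intersecting : ¬ Intersecting F
  ¬intersecting int = m+1+n≰m (length F) (ℓ≥γ F (proj₁ fam) (All.tabulate id) int)

  -- The members through `c` form an intersecting subfamily, so at least γ members avoid `c`. This
  -- is the source of m ≥ γ.
  star-deficit : ∀ c → length (filter (c ∈?_) F) + suc β ≤ length F
  star-deficit c = ℓ≥γ (filter (c ∈?_) F) (Unique.filter⁺ (c ∈?_) (proj₁ fam))
    (All.filter⁺ (c ∈?_) (All.tabulate id))
    λ A∈ B∈ → c , x∈p∩q⁺ (proj₂ (∈-filter⁻ (c ∈?_) {xs = F} A∈) , proj₂ (∈-filter⁻ (c ∈?_) {xs = F} B∈))

  avoider : ∀ c → ∃ λ B → B ∈ᴸ F × c ∉ B
  avoider c with Any.any? (λ B → ¬? (c ∈? B)) F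
  ... | yes any = find any
  ... | no ¬any = contradiction (λ {A} {B} A∈ B∈ → c , x∈p∩q⁺ (c∈ A∈ , c∈ B∈)) ¬intersecting
    where
    c∈ : ∀ {A} → A ∈ᴸ F → c ∈ A
    c∈ {A} A∈ = decidable-stable (c ∈? A) (λ c∉A → ¬any (lose A∈ c∉A))

  nonempty-family : ∃ λ A → A ∈ᴸ F
  nonempty-family = go F (≤-trans (s≤s z≤n) (ℓ≥γ [] [] [] (λ ())))
    where
    go : ∀ G → 1 ≤ length G → ∃ λ A → A ∈ᴸ G
    go (A ∷ _) _ = A , here refl

  -- For t = 1 `few-disjoint` allows no disjoint pair at all, and `F` would be intersecting.
  2≤t : ∀ {t} → 1 ≤ k → UnionIntersecting t F → 1 ≤ t → 2 ≤ t
  2≤t {t} 1≤k ui 1≤t = ≰⇒> λ t≤1 → ¬intersecting λ {A} {B} A∈ B∈ → decidable-stable (nonempty? (A ∩ B)) λ A∩B=∅ →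
    contradiction (≤-trans (∈-length (∈-filter⁺ (disjoint? A) B∈ A∩B=∅))
      (≤-trans (few-disjoint A∈) (∸-monoˡ-≤ 1 t≤1))) λ ()
    where open Families fam ui 1≤k 1≤t

theorem2 : ∀ (k t β : ℕ) → 5 ≤ k → 1 ≤ t → suc β ≤ k ∸ 2 →
    ∃ λ (n₀ : ℕ) → ∀ (n : ℕ) → n₀ ≤ n → ∀ (F : List (Subset n)) →
    KFamily n k F → UnionIntersecting t F → ℓ≥ (suc β) F →
    (length F ≤ bound n k t (suc β))
    × ((length F ≡ bound n k t (suc β) → IsoToJ n k t (suc β) F)
    × (IsoToJ n k t (suc β) F → length F ≡ bound n k t (suc β)))
theorem2 k t β 5≤k 1≤t γ≤k-2 = n₀ , main
  where
  γ = suc β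
  -- `n₁` makes n-2 exceed (k-2) `ratio k t`, as the heavy-pair count requires. `n₂` is the lower
  -- bound for n-k-γ in the kernel count: k dominates the lower index, t k t dominates m t for m ≤ t
  -- k, and 2 gives strictness and one Pascal step. The added k + k pays for k + γ.
  n₁ = 3 + (k ∸ 2) * ratio k t
  n₂ = 2 + k + t * k * t
  n₀ = n₁ + (k + k + n₂)

  1≤k : 1 ≤ k
  1≤k = ≤-trans (s≤s z≤n) 5≤k

  γ<k : γ < k
  γ<k = ≤-trans (s≤s γ≤k-2) (≤-trans (s≤s (∸-monoʳ-≤ k (s≤s {0} {1} z≤n))) (≤-reflexive (m+[n∸m]≡n 1≤k)))

  module _ {n : ℕ} (n₀≤n : n₀ ≤ n) {F : List (Subset n)} (fam : KFamily n k F) (ui : UnionIntersecting t F)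
    (ℓ≥γ : ℓ≥ γ F) where

    2k+n₂≤n : k + k + n₂ ≤ n
    2k+n₂≤n = ≤-trans (m≤n+m (k + k + n₂) n₁) n₀≤n

    n₂≤ : n₂ ≤ n ∸ k ∸ γ
    n₂≤ = begin
      n₂                          ≡⟨ m+n∸m≡n (k + k) n₂ ⟨
      k + k + n₂ ∸ (k + k)        ≤⟨ ∸-mono 2k+n₂≤n (+-monoʳ-≤ k (<⇒≤ γ<k)) ⟩
      n ∸ (k + γ)                 ≡⟨ ∸-+-assoc n k γ ⟨
      n ∸ k ∸ γ                   ∎
      where open ≤-Reasoning

    upper : bound n k t γ ≤ length F → length F ≤ bound n k t γ × (length F ≡ bound n k t γ → IsoToJ n k t γ F)
    upper big with Families.sunflower fam ui 1≤k 1≤t 5≤k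
        (≤-trans (≤-trans (m≤m+n k k) (m≤m+n (k + k) n₂)) 2k+n₂≤n)
        (∸-monoˡ-≤ 2 (≤-trans (m≤m+n n₁ (k + k + n₂)) n₀≤n))
        (≤-trans (≤-trans (m≤m+n _ _) (m≤m+n _ _)) big)
        (avoider fam ℓ≥γ) (proj₂ (nonempty-family fam ℓ≥γ))
    ... | c , E , ∣E∣ , c∉E , cover =
      Upper.upper-bound fam ui 5≤k (2≤t fam ℓ≥γ 1≤k ui 1≤t) γ≤k-2 n₂≤ ∣E∣ c∉E cover
        -- At least γ members avoid `c` by `star-deficit`, and distinct strays have distinct petals,
        -- so γ ≤ m.
        (≤-trans (+-cancelˡ-≤ (length (filter (c ∈?_) F)) γ _
          (≤-trans (star-deficit fam ℓ≥γ c) (≤-reflexive (sym (length-filter-split (c ∈?_) F)))))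
          (Counting.length-strays fam ui 1≤k 1≤t ∣E∣ c∉E cover))

    -- Only a family that reaches the bound has enough members for the heavy-pair argument. For a
    -- smaller one the inequality is immediate and equality is impossible.
    small-or-extremal : length F ≤ bound n k t γ × (length F ≡ bound n k t γ → IsoToJ n k t γ F)
    small-or-extremal with bound n k t γ ≤? length F
    ... | yes big = upper big
    ... | no ¬big = ≰⇒≥ ¬big , λ eq → contradiction (≤-reflexive (sym eq)) ¬big

  main : ∀ n → n₀ ≤ n → ∀ (F : List (Subset n)) → KFamily n k F → UnionIntersecting t F → ℓ≥ γ F →
    length F ≤ bound n k t γ × ((length F ≡ bound n k t γ → IsoToJ n k t γ F)
      × (IsoToJ n k t γ F → length F ≡ bound n k t γ))
  main n n₀≤n F fam ui ℓ≥γ with small-or-extremal n₀≤n fam ui ℓ≥γ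
  ... | le , eq⇒iso = le , eq⇒iso , λ iso → ≤-antisym le (IsoToJ⇒≥ γ<k 1≤t iso)
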